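{- Let $s,t\ge 1$ and let $k_1,\ldots,k_s$ and $l_1,\ldots,l_t$ be positive integers with $k_1+\cdots+k_s=l_1+\cdots+l_t$. Suppose the type $\Xi=\langle k_1,\ldots,k_s\,|\,l_1,\ldots,l_t\rangle$ is simple and non-decomposable. Then the cardinality of $\Xi$ is $|\Xi|=(s+t-2)!$.
   Context: A w-tree is a finite connected plane tree (embedded in the plane) in which every vertex and every edge carries a positive integer weight, such that the weight of each vertex equals the sum of the weights of the edges incident to it. The vertices of a tree are properly 2-colored, white and black (adjacent vertices have different colors). The type $\langle k_1,\ldots,k_s\,|\,l_1,\ldots,l_t\rangle$ (white weights $k_i$, black weights $l_j$, each list written in non-decreasing order, with $\sum k_i=\sum l_j$) is the set of w-trees having exactly $s$ white vertices with weights $k_1,\ldots,k_s$ and exactly $t$ black vertices with weights $l_1,\ldots,l_t$, considered up to orientation-preserving isotopy of the plane preserving colors and weights; $|\Xi|$ denotes the number of such pairwise non-isotopic w-trees. The type is simple if $k_1,\ldots,k_s$ are pairwise distinct and $l_1,\ldots,l_t$ are pairwise distinct. The type is decomposable if there exist a nonempty proper subset $I\subset\{1,\ldots,s\}$ and a nonempty proper subset $J\subset\{1,\ldots,t\}$ with $\sum_{i\in I}k_i=\sum_{j\in J}l_j$; otherwise it is non-decomposable. -}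

module Defs where

open import Data.Nat using (ℕ; zero; suc; _+_; _≤_)
open import Data.Fin using (Fin)
import Data.Fin as F
open import Data.Fin.Subset using (Subset; _∈_; Nonempty; ∁)
open import Data.Fin.Subset.Properties using (_∈?_)
open import Data.Bool using (if_then_else_)
open import Data.Product using (∃; Σ; _×_)
open import Data.List using (List)
open import Relation.Nullary using (¬_; does)
open import Relation.Binary.PropositionalEquality using (_≡_)
open import Function.Definitions using (Injective)

sumFin : (n : ℕ) → (Fin n → ℕ) → ℕ
sumFin zero    f = 0
sumFin (suc n) f = f F.zero + sumFin n (λ i → f (F.suc i))

subsetSum : {n : ℕ} → Subset n → (Fin n → ℕ) → ℕ
subsetSum {n} I f = sumFin n (λ i → if does (i ∈? I) then f i else 0)

incidentSum : {n m : ℕ} → (Fin n → Fin m) → (Fin n → ℕ) → Fin m → ℕ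
incidentSum {n} end c v = sumFin n (λ e → if does (end e F.≟ v) then c e else 0)

iter : {A : Set} → (A → A) → ℕ → A → A
iter f zero    x = x
iter f (suc m) x = f (iter f m x)

data Reach {n : ℕ} (σ α : Fin n → Fin n) : Fin n → Fin n → Set where
  here : ∀ {e} → Reach σ α e e
  viaσ : ∀ {e e'} → Reach σ α (σ e) e' → Reach σ α e e'
  viaα : ∀ {e e'} → Reach σ α (α e) e' → Reach σ α e e'

-- A w-tree of type ⟨k | l⟩, with white vertices labelled by Fin s and black
-- vertices by Fin t, encoded as a bipartite plane tree (combinatorial map):
-- edges Fin n, white endpoint wv, black endpoint bv, edge weight wt,
-- σ / α = counterclockwise successor of an edge around its white / black vertex.
record WTree {s t : ℕ} (k : Fin s → ℕ) (l : Fin t → ℕ) : Set where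
  field
    n      : ℕ
    wv     : Fin n → Fin s
    bv     : Fin n → Fin t
    wt     : Fin n → ℕ
    wt-pos : ∀ e → 1 ≤ wt e
    σ      : Fin n → Fin n
    α      : Fin n → Fin n
    σ-inj  : Injective _≡_ _≡_ σ
    α-inj  : Injective _≡_ _≡_ α
    σ-fib  : ∀ e → wv (σ e) ≡ wv e
    α-fib  : ∀ e → bv (α e) ≡ bv e
    σ-cyc  : ∀ e e' → wv e ≡ wv e' → ∃ λ m → iter σ m e ≡ e'
    α-cyc  : ∀ e e' → bv e ≡ bv e' → ∃ λ m → iter α m e ≡ e'
    white-weight : ∀ i → incidentSum wv wt i ≡ k i
    black-weight : ∀ j → incidentSum bv wt j ≡ l j
    edge-count   : n + 1 ≡ s + t
    connected    : ∀ e e' → Reach σ α e e'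

-- Isotopy (orientation-preserving, colour- and weight-preserving equivalence):
-- an isomorphism of the combinatorial maps which may permute vertices of equal weight.
record Isotopic {s t : ℕ} {k : Fin s → ℕ} {l : Fin t → ℕ} (T T' : WTree k l) : Set where
  private
    module A = WTree T
    module B = WTree T'
  field
    π      : Fin A.n → Fin B.n
    π-inj  : Injective _≡_ _≡_ π
    π-surj : ∀ e' → ∃ λ e → π e ≡ e'
    φ      : Fin s → Fin s
    ψ      : Fin t → Fin t
    φ-inj  : Injective _≡_ _≡_ φ
    ψ-inj  : Injective _≡_ _≡_ ψ
    φ-wt   : ∀ i → k (φ i) ≡ k i
    ψ-wt   : ∀ j → l (ψ j) ≡ l j
    π-wv   : ∀ e → B.wv (π e) ≡ φ (A.wv e)
    π-bv   : ∀ e → B.bv (π e) ≡ ψ (A.bv e)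
    π-wt   : ∀ e → B.wt (π e) ≡ A.wt e
    π-σ    : ∀ e → B.σ (π e) ≡ π (A.σ e)
    π-α    : ∀ e → B.α (π e) ≡ π (A.α e)

Simple : {s t : ℕ} → (Fin s → ℕ) → (Fin t → ℕ) → Set
Simple k l = Injective _≡_ _≡_ k × Injective _≡_ _≡_ l

NonDecomposable : {s t : ℕ} → (Fin s → ℕ) → (Fin t → ℕ) → Set
NonDecomposable {s} {t} k l =
  (I : Subset s) (J : Subset t) → Nonempty I → Nonempty (∁ I) →
  Nonempty J → Nonempty (∁ J) → ¬ (subsetSum I k ≡ subsetSum J l)

{-# OPTIONS --safe #-}
module Submission where

{-
Root a w-tree at a white vertex f.  Every edge then belongs to its end farther from f, so that the
n = s + t - 1 edges are named by the vertices other than f ("letters").  The face permutation ασ,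
"next edge around the white end, then next edge around the black end", is a cyclic permutation of the
letters, and it determines the tree: there are (n - 1)! of them.

Both facts are proved by pruning leaves.  If the cyclic permutation N takes a white letter v to a black
letter g, then in any tree with face permutation N either v is a leaf attached to g or g is a leaf
attached to v, and since k_v ≠ l_g by non-decomposability the weights decide which.  Removing the leaf
x bypasses x in N and subtracts its weight from its neighbour; this preserves non-decomposability, and
it can be undone.  When no such pair v, g is left, the tree is a star around f.
-}

open import Defs
open import Data.Nat using (ℕ; zero; suc; _+_; _*_; _∸_; _≤_; _<_; _!; z≤n; s≤s; s≤s⁻¹)
import Data.Nat as ℕ
open import Data.Nat.Properties
  using (+-assoc; +-comm; +-identityʳ; +-cancelʳ-≡; +-mono-≤; +-monoʳ-≤; +-monoˡ-<; *-comm;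
         ≤-refl; ≤-reflexive; ≤-trans; <-≤-trans; ≤-<-trans; <-trans; <-irrefl; <-asym; <⇒≤;
         m≤m+n; m<m+n; n<1+n; n≤0⇒n≡0; n≢0⇒n>0; m∸n+n≡m; m+n≡0⇒n≡0; m≤n⇒m≤o+n; ∸-monoʳ-<;
         <-cmp; +-0-commutativeMonoid)
open import Data.Fin using (Fin; zero; suc; toℕ; splitAt; _↑ˡ_; _↑ʳ_)
open import Data.Fin.Permutation using (permutation)
open import Data.Fin.Permutation.Components using (transpose; transpose-inverse)
open import Data.Fin.Properties
  using (_≟_; any?; pigeonhole; suc-injective; splitAt-↑ˡ; splitAt-↑ʳ; splitAt⁻¹-↑ˡ; splitAt⁻¹-↑ʳ)
open import Data.Fin.Subset using (_∈_; Nonempty; ∁)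
open import Data.Fin.Subset.Properties using (_∈?_; x∉p⇒x∈∁p)
open import Data.Bool using (Bool; true; false; if_then_else_)
open import Data.Bool.Properties using () renaming (_≟_ to _≟ᵇ_)
open import Data.Maybe using (Maybe; just; nothing)
open import Data.Maybe.Properties using (just-injective) renaming (≡-dec to Maybe-≡-dec)
open import Data.Product using (Σ; ∃; ∃₂; _×_; _,_; proj₁; proj₂)
open import Data.Sum using (_⊎_; inj₁; inj₂; [_,_]′)
open import Data.Empty using (⊥; ⊥-elim)
open import Data.Vec using (tabulate)
open import Data.Vec.Properties using (lookup∘tabulate; lookup⇒[]=; []=⇒lookup)
open import Data.List using (List; []; _∷_; map; length; allFin; cartesianProductWith)
open import Data.List.Properties using (length-map; length-++; length-tabulate)
open import Data.List.Membership.Propositional.Properties using (∈-allFin)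
open import Data.List.Relation.Unary.Any using (Any)
import Data.List.Relation.Unary.Any as Any
import Data.List.Relation.Unary.Any.Properties as Any
import Data.List.Relation.Unary.All as All
open import Data.List.Relation.Unary.AllPairs using (AllPairs; []; _∷_)
import Data.List.Relation.Unary.AllPairs as AllPairs
import Data.List.Relation.Unary.AllPairs.Properties as AllPairs
import Data.List.Relation.Unary.Unique.Setoid.Properties as Unique
import Data.List.Relation.Unary.Unique.Propositional.Properties as Unique≡
open import Function.Base using (_∘_; id; const)
open import Function.Bundles using (mk⇔)
open import Function.Definitions using (Injective)
open import Level using (0ℓ)
open import Relation.Nullary using (¬_; Dec; yes; no; does; contradiction)
open import Relation.Nullary.Decidable using (dec-true; dec-false; does-⇔; _×-dec_; _⊎-dec_; ¬?)
open import Relation.Binary.Bundles using (Setoid)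
open import Relation.Binary.Definitions using (DecidableEquality; tri<; tri≈; tri>)
open import Relation.Binary.PropositionalEquality
  using (_≡_; _≢_; _≗_; refl; sym; trans; cong; cong₂; subst; subst₂; module ≡-Reasoning)
import Relation.Binary.PropositionalEquality as ≡
import Algebra.Properties.CommutativeMonoid.Sum +-0-commutativeMonoid as Sum

-- The weights can decide because a leaf hanging at a letter is strictly lighter than its parent,
-- which bears the leaf's whole weight and also its own edge towards the root. So comparing the
-- weights of v and g gives the same answer in every tree with face permutation N. Leaves attached
-- to the root itself are never pruned. The weight `r` of the root therefore stays constant, and the
-- root can be kept outside the alphabet. A pruned letter remains in `Fin n`: its weight becomes 0
-- and all permutations fix it. This avoids re-indexing; in exchange many conditions concern letters
-- of nonzero weight alone. Each pruning lowers the total weight of the white letters, the measure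
-- of the pruning inductions. Acyclicity is recorded by a function `rank` decreasing towards the
-- root, which extends at once to a new leaf. Simplicity makes the vertices distinguishable:
-- distinct weights force an isotopy to fix every vertex.

-- Finite sums and conditionals

sumFin-cong : ∀ {n} {f g : Fin n → ℕ} → f ≗ g → sumFin n f ≡ sumFin n g
sumFin-cong {zero}  f≗g = refl
sumFin-cong {suc n} f≗g = cong₂ _+_ (f≗g zero) (sumFin-cong (f≗g ∘ suc))

sumFin-zero : ∀ {n} {f : Fin n → ℕ} → (∀ z → f z ≡ 0) → sumFin n f ≡ 0
sumFin-zero {zero}  f≡0 = refl
sumFin-zero {suc n} f≡0 = cong₂ _+_ (f≡0 zero) (sumFin-zero (f≡0 ∘ suc))

sumFin-bump : ∀ {n} {f g : Fin n → ℕ} {d} w → f w ≡ g w + d → (∀ z → z ≢ w → f z ≡ g z) →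
              sumFin n f ≡ sumFin n g + d
sumFin-bump {suc n} {f} {g} {d} zero fw eq = begin
  f zero + sumFin n (f ∘ suc)       ≡⟨ cong₂ _+_ fw (sumFin-cong (λ z → eq (suc z) λ ())) ⟩
  (g zero + d) + sumFin n (g ∘ suc) ≡⟨ +-assoc (g zero) d _ ⟩
  g zero + (d + sumFin n (g ∘ suc)) ≡⟨ cong (g zero +_) (+-comm d _) ⟩
  g zero + (sumFin n (g ∘ suc) + d) ≡⟨ +-assoc (g zero) _ d ⟨
  g zero + sumFin n (g ∘ suc) + d   ∎
  where open ≡-Reasoning
sumFin-bump {suc n} {f} {g} {d} (suc w) fw eq = begin
  f zero + sumFin n (f ∘ suc)       ≡⟨ cong₂ _+_ (eq zero λ ()) (sumFin-bump w fw (λ z z≢w → eq (suc z) (z≢w ∘ suc-injective))) ⟩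
  g zero + (sumFin n (g ∘ suc) + d) ≡⟨ +-assoc (g zero) _ d ⟨
  g zero + sumFin n (g ∘ suc) + d   ∎
  where open ≡-Reasoning

sumFin-single : ∀ {n} {f : Fin n → ℕ} w → (∀ z → z ≢ w → f z ≡ 0) → sumFin n f ≡ f w
sumFin-single {n} {f} w f≡0 =
  trans (sumFin-bump {g = const 0} w refl f≡0) (cong (_+ f w) (sumFin-zero {n} λ _ → refl))

term≤sumFin : ∀ {n} (f : Fin n → ℕ) i → f i ≤ sumFin n f
term≤sumFin f zero    = m≤m+n _ _
term≤sumFin f (suc i) = m≤n⇒m≤o+n (f zero) (term≤sumFin (f ∘ suc) i)

two-terms≤sumFin : ∀ {n} (f : Fin n → ℕ) {i j} → i ≢ j → f i + f j ≤ sumFin n f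
two-terms≤sumFin f {zero}  {zero}  i≢j = contradiction refl i≢j
two-terms≤sumFin f {zero}  {suc j} i≢j = +-monoʳ-≤ (f zero) (term≤sumFin (f ∘ suc) j)
two-terms≤sumFin f {suc i} {zero}  i≢j =
  ≤-trans (≤-reflexive (+-comm (f (suc i)) _)) (+-monoʳ-≤ (f zero) (term≤sumFin (f ∘ suc) i))
two-terms≤sumFin f {suc i} {suc j} i≢j =
  m≤n⇒m≤o+n (f zero) (two-terms≤sumFin (f ∘ suc) (i≢j ∘ cong suc))

sumFin-positive : ∀ {n} (f : Fin n → ℕ) → sumFin n f ≢ 0 → ∃ λ i → f i ≢ 0
sumFin-positive {zero}  f s≢0 = contradiction refl s≢0
sumFin-positive {suc n} f s≢0 with f zero in eq
... | suc m = zero , λ f0≡0 → case-suc (trans (sym eq) f0≡0)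
  where
  case-suc : suc m ≢ 0
  case-suc ()
... | zero with i , fi≢0 ← sumFin-positive (f ∘ suc) s≢0 = suc i , fi≢0

module _ {A B : Set} {a b : B} where

  if-yes : (d : Dec A) → A → (if does d then a else b) ≡ a
  if-yes d p = cong (if_then a else b) (dec-true d p)

  if-no : (d : Dec A) → ¬ A → (if does d then a else b) ≡ b
  if-no d ¬p = cong (if_then a else b) (dec-false d ¬p)

if≢0⇒ : ∀ {A : Set} (d : Dec A) {a : ℕ} → (if does d then a else 0) ≢ 0 → A
if≢0⇒ (yes p) _  = p
if≢0⇒ (no _)  ≢0 = contradiction refl ≢0

-- Transpositions, and bypassing a point of a permutation

module _ {n : ℕ} where

  private
    X = Fin n

  transpose-left : ∀ (i j : X) → transpose i j i ≡ j
  transpose-left i j with i ≟ i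
  ... | yes _  = refl
  ... | no i≢i = contradiction refl i≢i

  transpose-right : ∀ (i j : X) → transpose i j j ≡ i
  transpose-right i j with j ≟ i
  ... | yes j≡i = j≡i
  ... | no _ with j ≟ j
  ...   | yes _  = refl
  ...   | no j≢j = contradiction refl j≢j

  transpose-other : ∀ (i j : X) {k} → k ≢ i → k ≢ j → transpose i j k ≡ k
  transpose-other i j {k} k≢i k≢j with k ≟ i
  ... | yes k≡i = contradiction k≡i k≢i
  ... | no _ with k ≟ j
  ...   | yes k≡j = contradiction k≡j k≢j
  ...   | no _    = refl

  transpose-id : ∀ (i k : X) → transpose i i k ≡ k
  transpose-id i k with k ≟ i
  ... | yes k≡i = sym k≡i
  ... | no _ with k ≟ i
  ...   | yes k≡i = sym k≡i
  ...   | no _    = refl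

  transpose-swap : ∀ (i j k : X) → transpose i j k ≡ transpose j i k
  transpose-swap i j k = go (k ≟ i) (k ≟ j)
    where
    go : Dec (k ≡ i) → Dec (k ≡ j) → transpose i j k ≡ transpose j i k
    go (yes refl) _          = trans (transpose-left k j) (sym (transpose-right j k))
    go (no _)     (yes refl) = trans (transpose-right i k) (sym (transpose-left k i))
    go (no k≢i)   (no k≢j)   = trans (transpose-other i j k≢i k≢j) (sym (transpose-other j i k≢j k≢i))

  transpose-involutive : ∀ (i j k : X) → transpose i j (transpose i j k) ≡ k
  transpose-involutive i j k =
    trans (cong (transpose i j) (transpose-swap i j k)) (transpose-inverse i j)

  transpose-injective : ∀ (i j : X) → Injective _≡_ _≡_ (transpose i j)
  transpose-injective i j {x} {y} eq =
    trans (sym (transpose-involutive i j x)) (trans (cong (transpose i j) eq) (transpose-involutive i j y))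

  transpose-conj : ∀ {f : X → X} → Injective _≡_ _≡_ f → ∀ i j k →
                   f (transpose i j k) ≡ transpose (f i) (f j) (f k)
  transpose-conj {f} f-inj i j k with k ≟ i
  ... | yes refl = sym (transpose-left (f i) (f j))
  ... | no k≢i with k ≟ j
  ...   | yes refl = sym (transpose-right (f i) (f j))
  ...   | no k≢j   = sym (transpose-other (f i) (f j) (k≢i ∘ f-inj) (k≢j ∘ f-inj))

  transpose-preserves : ∀ {A : Set} (h : X → A) {i j} → h i ≡ h j → ∀ k → h (transpose i j k) ≡ h k
  transpose-preserves h {i} {j} hi≡hj k with k ≟ i
  ... | yes refl = sym hi≡hj
  ... | no _ with k ≟ j
  ...   | yes refl = hi≡hj
  ...   | no _     = refl

  -- Bypasses x in its cycle and makes it a fixed point.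
  skip : X → (X → X) → X → X
  skip x f y = transpose x (f x) (f y)

  skip-self : ∀ x (f : X → X) → skip x f x ≡ x
  skip-self x f = transpose-right x (f x)

  skip-fixed : ∀ {x} {f : X → X} → f x ≡ x → skip x f ≗ f
  skip-fixed {x} {f} fx≡x y = trans (cong (λ z → transpose x z (f y)) fx≡x) (transpose-id x (f y))

  skip-into : ∀ {x} (f : X → X) {y} → f y ≡ x → skip x f y ≡ f x
  skip-into {x} f fy≡x = trans (cong (transpose x (f x)) fy≡x) (transpose-left x (f x))

  skip-other : ∀ {x} {f : X → X} → Injective _≡_ _≡_ f → ∀ {y} → y ≢ x → f y ≢ x → skip x f y ≡ f y
  skip-other {x} {f} f-inj y≢x fy≢x = transpose-other x (f x) fy≢x (y≢x ∘ f-inj)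

  skip-injective : ∀ x {f : X → X} → Injective _≡_ _≡_ f → Injective _≡_ _≡_ (skip x f)
  skip-injective x {f} f-inj = f-inj ∘ transpose-injective x (f x)

  skip-cong : ∀ x {f g : X → X} → f ≗ g → skip x f ≗ skip x g
  skip-cong x f≗g y = cong₂ (transpose x) (f≗g x) (f≗g y)

  skip-preserves : ∀ {A : Set} (h : X → A) x {f : X → X} → (∀ z → h (f z) ≡ h z) → ∀ y → h (skip x f y) ≡ h y
  skip-preserves h x {f} h-inv y = trans (transpose-preserves h (sym (h-inv x)) (f y)) (h-inv y)

  -- The transposition in `skip` is an involution, so `f` is recovered from the bypass once the
  -- successor of `x` is known.
  skip-determines : ∀ {x} {f g : X → X} → skip x f ≗ skip x g → f x ≡ g x → f ≗ g
  skip-determines {x} {f} {g} skip≗ fx≡gx z = transpose-injective x (f x)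
    (trans (skip≗ z) (cong (λ y → transpose x y (g z)) (sym fx≡gx)))

  -- The predecessor of `x` serves as well: the bypass sends it to the successor of `x`.
  skip-determines′ : ∀ {x y} {f g : X → X} → skip x f ≗ skip x g → f y ≡ x → g y ≡ x → f ≗ g
  skip-determines′ {x} {y} {f} {g} skip≗ fy≡x gy≡x = skip-determines skip≗
    (trans (sym (skip-into f fy≡x)) (trans (skip≗ y) (skip-into g gy≡x)))

-- Orbits of a map and of an injection on a finite set

data Orbit {A : Set} (f : A → A) : A → A → Set where
  here : ∀ {x} → Orbit f x x
  step : ∀ {x y} → Orbit f (f x) y → Orbit f x y

module _ {A : Set} {f : A → A} where

  orbit-trans : ∀ {x y z} → Orbit f x y → Orbit f y z → Orbit f x z
  orbit-trans here     q = q
  orbit-trans (step p) q = step (orbit-trans p q)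

  orbit-≡ : ∀ {x y} → f x ≡ y → Orbit f x y
  orbit-≡ refl = step here

  orbit-fixed : ∀ {x y} → f x ≡ x → Orbit f x y → x ≡ y
  orbit-fixed fx≡x here     = refl
  orbit-fixed {y = y} fx≡x (step p) = trans (sym fx≡x) (orbit-fixed (cong f fx≡x) p)

  orbit-cong : ∀ {g : A → A} → f ≗ g → ∀ {x y} → Orbit f x y → Orbit g x y
  orbit-cong f≗g here = here
  orbit-cong {g} f≗g {x} {y} (step p) = step (subst (λ z → Orbit g z y) (f≗g x) (orbit-cong f≗g p))

  iter-suc : ∀ m x → iter f (suc m) x ≡ iter f m (f x)
  iter-suc zero    x = refl
  iter-suc (suc m) x = cong f (iter-suc m x)

  orbit⇒iter : ∀ {x y} → Orbit f x y → ∃ λ m → iter f m x ≡ y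
  orbit⇒iter here = 0 , refl
  orbit⇒iter {x} (step p) with m , eq ← orbit⇒iter p = suc m , trans (iter-suc m x) eq

  iter⇒orbit : ∀ m {x y} → iter f m x ≡ y → Orbit f x y
  iter⇒orbit zero    refl = here
  iter⇒orbit (suc m) {x} eq = step (iter⇒orbit m (trans (sym (iter-suc m x)) eq))

orbit-map : ∀ {A B : Set} {f : A → A} {g : B → B} (h : A → B) → (∀ x → h (f x) ≡ g (h x)) →
            ∀ {x y} → Orbit f x y → Orbit g (h x) (h y)
orbit-map h eq here = here
orbit-map {g = g} h eq {x} {y} (step p) = step (subst (λ z → Orbit g z (h y)) (eq x) (orbit-map h eq p))

module _ {n : ℕ} {f : Fin n → Fin n} (f-inj : Injective _≡_ _≡_ f) where

  iter-cancel : ∀ i j {x} → i < j → iter f i x ≡ iter f j x → ∃ λ m → iter f (suc m) x ≡ x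
  iter-cancel zero    (suc j) _         eq = j , sym eq
  iter-cancel (suc i) (suc j) (s≤s i<j) eq = iter-cancel i j i<j (f-inj eq)

  -- Two of the first `n + 1` iterates agree by pigeonhole, and injectivity cancels the steps they
  -- share.
  orbit-return : ∀ x → Orbit f (f x) x
  orbit-return x with i , j , i<j , eq ← pigeonhole (n<1+n n) (λ i → iter f (toℕ i) x)
    with m , eq′ ← iter-cancel (toℕ i) (toℕ j) i<j eq =
    iter⇒orbit m (trans (sym (iter-suc m x)) eq′)

  orbit-sym : ∀ {x y} → Orbit f x y → Orbit f y x
  orbit-sym here     = here
  orbit-sym (step p) = orbit-trans (orbit-sym p) (orbit-return _)

  preimage : ∀ x → ∃ λ y → f y ≡ x
  preimage x = go (orbit-return x)
    where
    go : ∀ {y} → Orbit f (f y) x → ∃ λ y → f y ≡ x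
    go {y} here = y , refl
    go (step p) = go p

  -- A passage through `x` takes two steps of `f`, which the bypass merges into one. Injectivity
  -- excludes that `x` is fixed once another point maps to it.
  orbit-skip : ∀ {x} {y z} → y ≢ x → z ≢ x → Orbit f y z → Orbit (skip x f) y z
  orbit-skip y≢x z≢x here = here
  orbit-skip {x} {y} {z} y≢x z≢x (step p) with f y ≟ x
  orbit-skip {x} {y} {z} y≢x z≢x (step p) | no fy≢x =
    step (subst (λ w → Orbit (skip x f) w z) (sym (skip-other f-inj y≢x fy≢x)) (orbit-skip fy≢x z≢x p))
  orbit-skip {y = y} y≢x z≢x (step here) | yes fy≡x = contradiction fy≡x z≢x
  orbit-skip {x} {y} {z} y≢x z≢x (step (step p)) | yes fy≡x =
    step (subst (λ w → Orbit (skip x f) w z) (trans (cong f fy≡x) (sym (skip-into f fy≡x)))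
      (orbit-skip (λ ffy≡x → y≢x (trans (sym (f-inj (trans ffy≡x (sym fy≡x)))) fy≡x)) z≢x p))

  orbit-unskip : ∀ x {y z} → Orbit (skip x f) y z → Orbit f y z
  orbit-unskip x here = here
  orbit-unskip x {y} {z} (step p) = orbit-trans (go (f y ≟ x) (y ≟ x)) (orbit-unskip x p)
    where
    go : Dec (f y ≡ x) → Dec (y ≡ x) → Orbit f y (skip x f y)
    go (yes fy≡x) _          = step (orbit-≡ (trans (cong f fy≡x) (sym (skip-into f fy≡x))))
    go (no _)     (yes refl) = subst (Orbit f y) (sym (skip-self y f)) here
    go (no fy≢x)  (no y≢x)   = orbit-≡ (sym (skip-other f-inj y≢x fy≢x))

-- Colours, weights after removing a leaf, and genericity

data Colour : Set where
  white black : Colour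

opp : Colour → Colour
opp white = black
opp black = white

opp-≢ : ∀ c → opp c ≢ c
opp-≢ white ()
opp-≢ black ()

opp-opp : ∀ c → opp (opp c) ≡ c
opp-opp white = refl
opp-opp black = refl

_≟ᶜ_ : DecidableEquality Colour
white ≟ᶜ white = yes refl
white ≟ᶜ black = no λ ()
black ≟ᶜ white = no λ ()
black ≟ᶜ black = yes refl

same-or-opp : ∀ c d → c ≡ d ⊎ c ≡ opp d
same-or-opp white white = inj₁ refl
same-or-opp white black = inj₂ refl
same-or-opp black white = inj₂ refl
same-or-opp black black = inj₁ refl

if-0 : ∀ (b : Bool) {k} → k ≡ 0 → (if b then k else 0) ≡ 0
if-0 true  k≡0 = k≡0
if-0 false _   = refl

if-+ : ∀ (b : Bool) {k l m} → k ≡ l + m →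
       (if b then k else 0) ≡ (if b then l else 0) + (if b then m else 0)
if-+ true  eq = eq
if-+ false _  = refl

module _ {n : ℕ} where

  private
    X = Fin n

  -- The weights after removing a leaf `x` attached to `y`. Weight 0 marks `x` as absent; under
  -- `val x < val y` the `∸` is a true difference.
  reduce : X → X → (X → ℕ) → X → ℕ
  reduce x y val z = if does (z ≟ x) then 0 else if does (z ≟ y) then val y ∸ val x else val z

  module _ (x y : X) (val : X → ℕ) where

    reduce-leaf : reduce x y val x ≡ 0
    reduce-leaf = if-yes (x ≟ x) refl

    reduce-parent : x ≢ y → val x < val y → reduce x y val y + val x ≡ val y
    reduce-parent x≢y x<y = trans
      (cong (_+ val x) (trans (if-no (y ≟ x) (x≢y ∘ sym)) (if-yes (y ≟ y) refl)))
      (m∸n+n≡m (<⇒≤ x<y))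

    reduce-parent≢0 : x ≢ y → val x < val y → reduce x y val y ≢ 0
    reduce-parent≢0 x≢y x<y eq =
      <-irrefl (trans (cong (_+ val x) (sym eq)) (reduce-parent x≢y x<y)) x<y

    reduce-other : ∀ {z} → z ≢ x → z ≢ y → reduce x y val z ≡ val z
    reduce-other {z} z≢x z≢y = trans (if-no (z ≟ x) z≢x) (if-no (z ≟ y) z≢y)

    reduce-inactive : val x < val y → ∀ {z} → val z ≡ 0 → reduce x y val z ≡ 0
    reduce-inactive x<y {z} vz≡0 with z ≟ x
    ... | yes _ = refl
    ... | no _ with z ≟ y
    ...   | yes refl = contradiction (subst (val x <_) vz≡0 x<y) λ ()
    ...   | no _     = vz≡0

    reduce≡0 : x ≢ y → val x < val y → ∀ {z} → reduce x y val z ≡ 0 → z ≢ x → val z ≡ 0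
    reduce≡0 x≢y x<y {z} rz≡0 z≢x = go (z ≟ y)
      where
      go : Dec (z ≡ y) → val z ≡ 0
      go (yes refl) = contradiction rz≡0 (reduce-parent≢0 x≢y x<y)
      go (no z≢y)   = trans (sym (reduce-other z≢x z≢y)) rz≡0

module _ {n : ℕ} (col : Fin n → Colour) where

  private
    X = Fin n

  colourTerm : Colour → (X → Bool) → (X → ℕ) → X → ℕ
  colourTerm c P val z = if P z then (if does (col z ≟ᶜ c) then val z else 0) else 0

  colourSum : Colour → (X → Bool) → (X → ℕ) → ℕ
  colourSum c P val = sumFin n (colourTerm c P val)

  module _ {c : Colour} (P : X → Bool) where

    colourTerm-on : ∀ val {z} → col z ≡ c → colourTerm c P val z ≡ (if P z then val z else 0)
    colourTerm-on val {z} eq = cong (if P z then_else 0) (if-yes (col z ≟ᶜ c) eq)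

    colourTerm-off : ∀ val {z} → col z ≢ c → colourTerm c P val z ≡ 0
    colourTerm-off val {z} ne = if-0 (P z) (if-no (col z ≟ᶜ c) ne)

    colourTerm-zero : ∀ val {z} → val z ≡ 0 → colourTerm c P val z ≡ 0
    colourTerm-zero val {z} vz≡0 = if-0 (P z) (if-0 (does (col z ≟ᶜ c)) vz≡0)

    colourTerm-cong : ∀ val val′ {z} → val z ≡ val′ z → colourTerm c P val z ≡ colourTerm c P val′ z
    colourTerm-cong val val′ {z} = cong (λ k → if P z then (if does (col z ≟ᶜ c) then k else 0) else 0)

  -- Non-decomposability, with the root, a white vertex without letter, always outside of P.
  -- Letters of weight 0 count as absent.
  Generic : (X → ℕ) → Set
  Generic val = ∀ P → colourSum white P val ≡ colourSum black P val → ∀ z → P z ≡ true → val z ≡ 0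

  module _ {x y : X} {val : X → ℕ} (opposite : col y ≡ opp (col x)) (x<y : val x < val y) where

    private
      val′ = reduce x y val

      x≢y : x ≢ y
      x≢y refl = opp-≢ (col x) (sym opposite)

    colourSum-reduce : ∀ c P → P x ≡ P y →
                       colourSum c P val ≡ colourSum c P val′ + (if P x then val x else 0)
    colourSum-reduce c P Px≡Py with same-or-opp c (col x)
    ... | inj₁ refl = sumFin-bump x at-x λ z z≢x → elsewhere z z≢x (z ≟ y)
      where
      at-x : colourTerm c P val x ≡ colourTerm c P val′ x + (if P x then val x else 0)
      at-x = trans (colourTerm-on P val refl)
        (cong (_+ (if P x then val x else 0)) (sym (colourTerm-zero P val′ {x} (reduce-leaf x y val))))
      elsewhere : ∀ z → z ≢ x → Dec (z ≡ y) → colourTerm c P val z ≡ colourTerm c P val′ z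
      elsewhere z z≢x (no z≢y) = colourTerm-cong P val val′ (sym (reduce-other x y val z≢x z≢y))
      elsewhere _ z≢x (yes refl) = trans (colourTerm-off P val ne) (sym (colourTerm-off P val′ ne))
        where
        ne : col y ≢ col x
        ne eq = opp-≢ (col x) (trans (sym opposite) eq)
    ... | inj₂ refl = sumFin-bump y at-y λ z z≢y → elsewhere z z≢y (z ≟ x)
      where
      at-y : colourTerm c P val y ≡ colourTerm c P val′ y + (if P x then val x else 0)
      at-y = begin
        colourTerm c P val y
          ≡⟨ colourTerm-on P val opposite ⟩
        (if P y then val y else 0)
          ≡⟨ if-+ (P y) (sym (reduce-parent x y val x≢y x<y)) ⟩
        (if P y then val′ y else 0) + (if P y then val x else 0)
          ≡⟨ cong₂ _+_ (colourTerm-on P val′ opposite) (cong (if_then val x else 0) Px≡Py) ⟨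
        colourTerm c P val′ y + (if P x then val x else 0) ∎
        where open ≡-Reasoning
      elsewhere : ∀ z → z ≢ y → Dec (z ≡ x) → colourTerm c P val z ≡ colourTerm c P val′ z
      elsewhere z z≢y (no z≢x) = colourTerm-cong P val val′ (sym (reduce-other x y val z≢x z≢y))
      elsewhere _ z≢y (yes refl) = trans (colourTerm-off P val ne) (sym (colourTerm-off P val′ ne))
        where
        ne : col x ≢ opp (col x)
        ne = opp-≢ (col x) ∘ sym

    -- Given a set `P` balanced for the reduced weights, let `x` belong to it exactly when `y` does.
    -- The reduced sums do not change, as `x` has reduced weight 0, and the original sums exceed
    -- them by the same amount in both colours. So the new set is balanced for `val`.
    reduce-generic : Generic val → Generic val′
    reduce-generic gen P balanced z Pz = conclude (z ≟ x) (z ≟ y)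
      where
      P′ : X → Bool
      P′ z = if does (z ≟ x) then P y else P z

      P′x≡P′y : P′ x ≡ P′ y
      P′x≡P′y = trans (if-yes (x ≟ x) refl) (sym (if-no (y ≟ x) (x≢y ∘ sym)))

      colourSum-P′ : ∀ c → colourSum c P′ val′ ≡ colourSum c P val′
      colourSum-P′ c = sumFin-cong λ z → same {z} (z ≟ x)
        where
        same : ∀ {z} → Dec (z ≡ x) → colourTerm c P′ val′ z ≡ colourTerm c P val′ z
        same (yes refl) = trans (colourTerm-zero P′ val′ {x} (reduce-leaf x y val)) (sym (colourTerm-zero P val′ {x} (reduce-leaf x y val)))
        same {z} (no z≢x) = cong (if_then (if does (col z ≟ᶜ c) then val′ z else 0) else 0) (if-no (z ≟ x) z≢x)

      balanced′ : ∀ c → colourSum c P′ val ≡ colourSum c P val′ + (if P′ x then val x else 0)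
      balanced′ c = trans (colourSum-reduce c P′ P′x≡P′y) (cong (_+ _) (colourSum-P′ c))

      zero-on-P′ : ∀ z → P′ z ≡ true → val z ≡ 0
      zero-on-P′ = gen P′ (trans (balanced′ white) (trans (cong (_+ _) balanced) (sym (balanced′ black))))

      conclude : Dec (z ≡ x) → Dec (z ≡ y) → val′ z ≡ 0
      conclude (yes refl) _ = reduce-leaf x y val
      conclude (no z≢x) _ = reduce-inactive x y val x<y (zero-on-P′ z (trans (if-no (z ≟ x) z≢x) Pz))

    whole-reduce : ∀ c → colourSum c (const true) val ≡ colourSum c (const true) val′ + val x
    whole-reduce c = colourSum-reduce c (const true) refl

    white-decreases : val x ≢ 0 → colourSum white (const true) val′ < colourSum white (const true) val
    white-decreases vx≢0 = subst (colourSum white (const true) val′ <_) (sym (whole-reduce white))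
      (m<m+n _ (n≢0⇒n>0 vx≢0))

-- Degrees of vertices

module _ {n : ℕ} where

  _≟ᵛ_ : DecidableEquality (Maybe (Fin n))
  _≟ᵛ_ = Maybe-≡-dec _≟_

  incidence : (Fin n → Maybe (Fin n)) → (Fin n → ℕ) → Maybe (Fin n) → Fin n → ℕ
  incidence end wt v z = if does (end z ≟ᵛ v) then wt z else 0

  degree : (Fin n → Maybe (Fin n)) → (Fin n → ℕ) → Maybe (Fin n) → ℕ
  degree end wt v = sumFin n (incidence end wt v)

  module _ (end end′ : Fin n → Maybe (Fin n)) (wt wt′ : Fin n → ℕ) (x : Fin n)
           (leafless : wt′ x ≡ 0)
           (same-end : ∀ z → z ≢ x → end z ≡ end′ z) (same-wt : ∀ z → z ≢ x → wt z ≡ wt′ z) where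

    -- Used in both directions: the primed data belong to the pruned tree in `prune`, and to the
    -- tree before the insertion in `graft`.
    degree-remove : ∀ v → degree end wt v ≡ degree end′ wt′ v + incidence end wt v x
    degree-remove v = sumFin-bump x
      (cong (_+ incidence end wt v x) (sym (if-0 (does (end′ x ≟ᵛ v)) leafless)))
      λ z z≢x → cong₂ (λ u k → if does (u ≟ᵛ v) then k else 0) (same-end z z≢x) (same-wt z z≢x)

    degree-remove-here : ∀ {v} → end x ≡ v → degree end wt v ≡ degree end′ wt′ v + wt x
    degree-remove-here {v} eq =
      trans (degree-remove v) (cong (degree end′ wt′ v +_) (if-yes (end x ≟ᵛ v) eq))

    degree-remove-elsewhere : ∀ {v} → end x ≢ v → degree end wt v ≡ degree end′ wt′ v
    degree-remove-elsewhere {v} ne =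
      trans (degree-remove v) (trans (cong (degree end′ wt′ v +_) (if-no (end x ≟ᵛ v) ne)) (+-identityʳ _))

-- Rooted w-trees written in letters

module Coding {n : ℕ} (col : Fin n → Colour) where

  X : Set
  X = Fin n

  -- A w-tree rooted at a white vertex of weight r (the vertex `nothing`).  The letter x : X names
  -- both a non-root vertex, of weight val x, and the edge from it towards the root.  Letters of
  -- weight 0 are unused.
  record Coded (r : ℕ) (val : X → ℕ) : Set where
    field
      rot      : Colour → X → X
      end      : Colour → X → Maybe X
      wt rank  : X → ℕ
      rot-inj  : ∀ c → Injective _≡_ _≡_ (rot c)
      rot-end  : ∀ c x → end c (rot c x) ≡ end c x
      rot-cyc  : ∀ c x y → val x ≢ 0 → val y ≢ 0 → end c x ≡ end c y → Orbit (rot c) x y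
      rot-fix  : ∀ c x → val x ≡ 0 → rot c x ≡ x
      own      : ∀ x → end (col x) x ≡ just x
      typed    : ∀ c x y → end c x ≡ just y → col y ≡ c
      rooted   : ∀ x → end black x ≢ nothing
      ranked   : ∀ x y → val x ≢ 0 → end (opp (col x)) x ≡ just y → rank y < rank x
      wt-zero  : ∀ x → val x ≡ 0 → wt x ≡ 0
      wt-pos   : ∀ x → val x ≢ 0 → wt x ≢ 0
      deg      : ∀ y → degree (end (col y)) wt (just y) ≡ val y
      deg-root : degree (end white) wt nothing ≡ r

    -- The face permutation: it traverses each edge once, from its black to its white end.
    face : X → X
    face x = rot black (rot white x)

    face-inj : Injective _≡_ _≡_ face
    face-inj = rot-inj white ∘ rot-inj black

  open Coded

  -- Leaves and pruning

  module _ {r : ℕ} {val : X → ℕ} (C : Coded r val) where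

    rot-active : ∀ c {x} → val x ≢ 0 → val (rot C c x) ≢ 0
    rot-active c {x} vx≢0 v≡0 = vx≢0 (trans (cong val (sym (rot-inj C c (rot-fix C c _ v≡0)))) v≡0)

    incidence≤ : ∀ c x v → end C c x ≡ v → wt C x ≤ degree (end C c) (wt C) v
    incidence≤ c x v eq = ≤-trans (≤-reflexive (sym (if-yes (end C c x ≟ᵛ v) eq)))
      (term≤sumFin (incidence (end C c) (wt C) v) x)

    end-active : ∀ c {x y} → wt C x ≢ 0 → end C c x ≡ just y → val y ≢ 0
    end-active c {x} {y} wx≢0 eq vy≡0 with refl ← typed C c x y eq =
      wx≢0 (n≤0⇒n≡0 (subst (wt C x ≤_) (trans (deg C y) vy≡0) (incidence≤ c x (just y) eq)))

    sole-wt : ∀ {x} → (∀ z → z ≢ x → end C (col x) z ≡ just x → wt C z ≡ 0) → wt C x ≡ val x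
    sole-wt {x} others = begin
      wt C x                                      ≡⟨ if-yes (end C (col x) x ≟ᵛ just x) (own C x) ⟨
      incidence (end C (col x)) (wt C) (just x) x ≡⟨ sumFin-single x zeros ⟨
      degree (end C (col x)) (wt C) (just x)      ≡⟨ deg C x ⟩
      val x                                       ∎
      where
      open ≡-Reasoning
      zeros : ∀ z → z ≢ x → incidence (end C (col x)) (wt C) (just x) z ≡ 0
      zeros z z≢x with end C (col x) z ≟ᵛ just x
      ... | yes eq = others z z≢x eq
      ... | no _   = refl

    -- `alone` says that the rotation around the vertex `x` has its own edge as a fixed point, so no
    -- other active edge meets `x`. As `attached` asks for a letter, leaves at the root do not
    -- qualify.
    record Leaf (x y : X) : Set where
      field
        active   : val x ≢ 0
        alone    : rot C (col x) x ≡ x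
        attached : end C (opp (col x)) x ≡ just y

    module _ {x y : X} (leaf : Leaf x y) where
      open Leaf leaf

      leaf-opposite : col y ≡ opp (col x)
      leaf-opposite = typed C _ x y attached

      leaf≢parent : x ≢ y
      leaf≢parent refl = opp-≢ (col x) (sym leaf-opposite)

      leaf-alone : ∀ z → z ≢ x → end C (col x) z ≡ just x → wt C z ≡ 0
      leaf-alone z z≢x eq with val z ℕ.≟ 0
      ... | yes vz≡0 = wt-zero C z vz≡0
      ... | no vz≢0  = contradiction
        (sym (orbit-fixed alone (rot-cyc C (col x) x z active vz≢0 (trans (own C x) (sym eq))))) z≢x

      leaf-wt : wt C x ≡ val x
      leaf-wt = sole-wt leaf-alone

      parent-active : val y ≢ 0
      parent-active = end-active (opp (col x)) (wt-pos C x active) attached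

      -- The edges named `x` and `y` are distinct and both meet the vertex `y`; the first has weight
      -- `val x`, the second a positive weight.
      leaf<parent : val x < val y
      leaf<parent = <-≤-trans (m<m+n (val x) (n≢0⇒n>0 (wt-pos C y parent-active)))
        (subst (_≤ val y) (cong₂ _+_ at-x at-y)
          (subst (_ ≤_) (deg C y) (two-terms≤sumFin (incidence (end C (col y)) (wt C) (just y)) leaf≢parent)))
        where
        at-x : incidence (end C (col y)) (wt C) (just y) x ≡ val x
        at-x = trans (if-yes (end C (col y) x ≟ᵛ just y) (trans (cong (λ c → end C c x) leaf-opposite) attached)) leaf-wt
        at-y : incidence (end C (col y)) (wt C) (just y) y ≡ wt C y
        at-y = if-yes (end C (col y) y ≟ᵛ just y) (own C y)

      private
        val′ = reduce x y val

      active′ : ∀ {z} → val′ z ≢ 0 → z ≢ x × val z ≢ 0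
      active′ vz≢0 = (λ { refl → vz≢0 (reduce-leaf x y val) }) , vz≢0 ∘ reduce-inactive x y val leaf<parent

      inactive′ : ∀ {z} → z ≢ x → val z ≢ 0 → val′ z ≢ 0
      inactive′ z≢x vz≢0 v′z≡0 = vz≢0 (reduce≡0 x y val leaf≢parent leaf<parent v′z≡0 z≢x)

      -- `end` can stay as it is, even at `x`, because an edge of weight 0 adds nothing to a degree.
      prune : Coded r val′
      prune .rot c = skip x (rot C c)
      prune .end = end C
      prune .wt z = if does (z ≟ x) then 0 else wt C z
      prune .rank = rank C
      prune .rot-inj c = skip-injective x (rot-inj C c)
      prune .rot-end c = skip-preserves (end C c) x (rot-end C c)
      prune .rot-cyc c y z vy≢0 vz≢0 eq = orbit-skip (rot-inj C c) (proj₁ (active′ vy≢0)) (proj₁ (active′ vz≢0))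
        (rot-cyc C c y z (proj₂ (active′ vy≢0)) (proj₂ (active′ vz≢0)) eq)
      prune .rot-fix c z v′z≡0 = go (z ≟ x)
        where
        go : Dec (z ≡ x) → skip x (rot C c) z ≡ z
        go (yes refl) = skip-self x (rot C c)
        go (no z≢x) = trans (skip-other (rot-inj C c) z≢x (z≢x ∘ trans (sym fixed))) fixed
          where
          fixed : rot C c z ≡ z
          fixed = rot-fix C c z (reduce≡0 x y val leaf≢parent leaf<parent v′z≡0 z≢x)
      prune .own = own C
      prune .typed = typed C
      prune .rooted = rooted C
      prune .ranked z w v′z≢0 = ranked C z w (proj₂ (active′ v′z≢0))
      prune .wt-zero z v′z≡0 = go (z ≟ x)
        where
        go : Dec (z ≡ x) → prune .wt z ≡ 0
        go (yes refl) = if-yes (x ≟ x) refl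
        go (no z≢x) = trans (if-no (z ≟ x) z≢x)
          (wt-zero C z (reduce≡0 x y val leaf≢parent leaf<parent v′z≡0 z≢x))
      prune .wt-pos z v′z≢0 = wt-pos C z (proj₂ (active′ v′z≢0)) ∘ trans (sym (if-no (z ≟ x) (proj₁ (active′ v′z≢0))))
      prune .deg w = go (w ≟ x) (w ≟ y)
        where
        wt′ = prune .wt
        wt-other : ∀ z → z ≢ x → wt C z ≡ wt′ z
        wt-other z z≢x = sym (if-no (z ≟ x) z≢x)
        at : ∀ {v} c → end C c x ≡ v → degree (end C c) (wt C) v ≡ degree (end C c) wt′ v + val x
        at {v} c eq = trans
          (degree-remove-here (end C c) (end C c) (wt C) wt′ x (if-yes (x ≟ x) refl) (λ _ _ → refl) wt-other eq)
          (cong (degree (end C c) wt′ v +_) leaf-wt)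
        go : Dec (w ≡ x) → Dec (w ≡ y) → degree (end C (col w)) wt′ (just w) ≡ val′ w
        go (yes refl) _ = +-cancelʳ-≡ (val x) _ _
          (trans (sym (at (col x) (own C x))) (trans (deg C x) (cong (_+ val x) (sym (reduce-leaf x y val)))))
        go (no _) (yes refl) = +-cancelʳ-≡ (val x) _ _
          (trans (sym (at (col y) (trans (cong (λ c → end C c x) leaf-opposite) attached)))
            (trans (deg C y) (sym (reduce-parent x y val leaf≢parent leaf<parent))))
        go (no w≢x) (no w≢y) = trans
          (sym (degree-remove-elsewhere (end C (col w)) (end C (col w)) (wt C) wt′ x (if-yes (x ≟ x) refl) (λ _ _ → refl) wt-other ne))
          (trans (deg C w) (sym (reduce-other x y val w≢x w≢y)))
          where
          ne : end C (col w) x ≢ just w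
          ne eq with same-or-opp (col w) (col x)
          ... | inj₁ c≡ = w≢x (just-injective (trans (sym eq) (trans (cong (λ c → end C c x) c≡) (own C x))))
          ... | inj₂ c≡ = w≢y (just-injective (trans (sym eq) (trans (cong (λ c → end C c x) c≡) attached)))
      prune .deg-root = trans
        (sym (degree-remove-elsewhere (end C white) (end C white) (wt C) (prune .wt) x (if-yes (x ≟ x) refl)
          (λ _ _ → refl) (λ z z≢x → sym (if-no (z ≟ x) z≢x)) ne))
        (deg-root C)
        where
        ne : end C white x ≢ nothing
        ne eq with same-or-opp white (col x)
        ... | inj₁ c≡ = contradiction (trans (sym eq) (trans (cong (λ c → end C c x) c≡) (own C x))) λ ()
        ... | inj₂ c≡ = contradiction (trans (sym eq) (trans (cong (λ c → end C c x) c≡) attached)) λ ()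

      -- The rotation at the colour of `x` fixes `x`, so bypassing `x` there has no effect. The
      -- transposition bypassing `x` in the other rotation is already outermost, or is moved there
      -- by conjugation.
      face-prune : face prune ≗ skip x (face C)
      face-prune z with same-or-opp (col x) white
      ... | inj₁ col≡ = begin
        skip x α (skip x σ z)      ≡⟨ cong (skip x α) (skip-fixed {f = σ} σx≡x z) ⟩
        transpose x (α x) (α (σ z)) ≡⟨ cong (λ y → transpose x (α y) (α (σ z))) σx≡x ⟨
        skip x (face C) z          ∎
        where
        open ≡-Reasoning
        σ = rot C white
        α = rot C black
        σx≡x : σ x ≡ x
        σx≡x = trans (cong (λ c → rot C c x) (sym col≡)) alone
      ... | inj₂ col≡ = begin
        skip x α (skip x σ z)                   ≡⟨ skip-fixed {f = α} αx≡x (skip x σ z) ⟩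
        α (transpose x (σ x) (σ z))             ≡⟨ transpose-conj (rot-inj C black) x (σ x) (σ z) ⟩
        transpose (α x) (α (σ x)) (α (σ z))     ≡⟨ cong (λ y → transpose y (α (σ x)) (α (σ z))) αx≡x ⟩
        skip x (face C) z                       ∎
        where
        open ≡-Reasoning
        σ = rot C white
        α = rot C black
        αx≡x : α x ≡ x
        αx≡x = trans (cong (λ c → rot C c x) (sym col≡)) alone

  -- Peaks of the face permutation, and trees without a peak

  Peak : (X → ℕ) → (X → X) → Set
  Peak val N = ∃ λ v → (val v ≢ 0 × col v ≡ white) × col (N v) ≡ black

  peak? : ∀ val N → Dec (Peak val N)
  peak? val N = any? λ v → (¬? (val v ℕ.≟ 0) ×-dec (col v ≟ᶜ white)) ×-dec (col (N v) ≟ᶜ black)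

  module _ {r : ℕ} {val : X → ℕ} (C : Coded r val) where

    same-colour-end : ∀ {x y} → end C (col x) x ≡ end C (col x) y → col y ≡ col x → x ≡ y
    same-colour-end {x} {y} eq col≡ = just-injective
      (trans (sym (own C x)) (trans eq (trans (cong (λ c → end C c y) (sym col≡)) (own C y))))

    -- Letters of a vertex's own colour around it coincide, so the two steps of the face permutation
    -- from v to g cannot both be proper.
    peak-leaf : ∀ {v g} → val v ≢ 0 → col v ≡ white → col g ≡ black → face C v ≡ g →
                (Leaf C v g × rot C black v ≡ g) ⊎ (Leaf C g v × rot C white v ≡ g)
    peak-leaf {v} {g} vv≢0 v-white g-black N≡g with same-or-opp (col (rot C white v)) white
    ... | inj₁ σv-white = inj₁ (record { active = vv≢0 ; alone = alone ; attached = attached } , αv≡g)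
      where
      alone : rot C (col v) v ≡ v
      alone = trans (cong (λ c → rot C c v) v-white)
        (sym (same-colour-end (trans (cong (λ c → end C c v) v-white)
          (trans (sym (rot-end C white v)) (cong (λ c → end C c (rot C white v)) (sym v-white))))
          (trans σv-white (sym v-white))))
      σv≡v : rot C white v ≡ v
      σv≡v = trans (cong (λ c → rot C c v) (sym v-white)) alone
      αv≡g : rot C black v ≡ g
      αv≡g = trans (cong (rot C black) (sym σv≡v)) N≡g
      attached : end C (opp (col v)) v ≡ just g
      attached = begin
        end C (opp (col v)) v     ≡⟨ cong (λ c → end C (opp c) v) v-white ⟩
        end C black v             ≡⟨ rot-end C black v ⟨
        end C black (rot C black v) ≡⟨ cong₂ (end C) (sym g-black) αv≡g ⟩
        end C (col g) g           ≡⟨ own C g ⟩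
        just g                    ∎
        where open ≡-Reasoning
    ... | inj₂ σv-black = inj₂ (record { active = vg≢0 ; alone = alone ; attached = attached } , σv≡g)
      where
      vg≢0 : val g ≢ 0
      vg≢0 = subst (λ z → val z ≢ 0) N≡g (rot-active C black (rot-active C white vv≢0))
      σv≡g : rot C white v ≡ g
      σv≡g = sym (same-colour-end
        (trans (cong₂ (end C) g-black (sym N≡g))
          (trans (rot-end C black _) (cong (λ c → end C c (rot C white v)) (sym g-black))))
        (trans σv-black (sym g-black)))
      alone : rot C (col g) g ≡ g
      alone = trans (cong₂ (rot C) g-black (sym σv≡g)) N≡g
      attached : end C (opp (col g)) g ≡ just v
      attached = begin
        end C (opp (col g)) g       ≡⟨ cong (λ c → end C (opp c) g) g-black ⟩
        end C white g               ≡⟨ cong (end C white) (sym σv≡g) ⟩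
        end C white (rot C white v) ≡⟨ rot-end C white v ⟩
        end C white v               ≡⟨ cong (λ c → end C c v) (sym v-white) ⟩
        end C (col v) v             ≡⟨ own C v ⟩
        just v                      ∎
        where open ≡-Reasoning

    module _ (flat : ¬ Peak val (face C)) where

      private
        M = sumFin n (rank C)

        stays-white : ∀ {v} → val v ≢ 0 → col v ≡ white → col (face C v) ≡ white
        stays-white {v} vv≢0 v-white with same-or-opp (col (face C v)) white
        ... | inj₁ N-white = N-white
        ... | inj₂ N-black = contradiction (v , (vv≢0 , v-white) , N-black) flat

        -- Every white letter around the black vertex b is followed by a white one, so one of them has
        -- a child, whose own first child is white again: the ranks would grow forever.
        ascend : ∀ m b z → M ∸ rank C b < m → val b ≢ 0 → col b ≡ black →
                 val z ≢ 0 → col z ≡ white → end C black z ≡ just b → Orbit (rot C black) z b → ⊥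
        ascend m b .b _ _ b-black _ z-white _ here = contradiction (trans (sym z-white) b-black) λ ()
        ascend m b z M∸b<m vb≢0 b-black vz≢0 z-white z-end (step p)
          with same-or-opp (col (rot C white z)) white
        ascend m b z M∸b<m vb≢0 b-black vz≢0 z-white z-end (step p) | inj₁ y-white = ascend m b (rot C black z) M∸b<m vb≢0 b-black (rot-active C black vz≢0)
          (subst (λ w → col (rot C black w) ≡ white) y≡z (stays-white vz≢0 z-white))
          (trans (rot-end C black z) z-end) p
          where
          y≡z : rot C white z ≡ z
          y≡z = sym (same-colour-end (trans (cong (λ c → end C c z) z-white)
            (trans (sym (rot-end C white z)) (cong (λ c → end C c (rot C white z)) (sym z-white))))
            (trans y-white (sym z-white)))
        ascend zero b z () vb≢0 b-black vz≢0 z-white z-end (step p) | inj₂ y-black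
        ascend (suc m) b z M∸b<m vb≢0 b-black vz≢0 z-white z-end (step p) | inj₂ y-black = ascend m y (face C z)
          (<-≤-trans (∸-monoʳ-< b<y (term≤sumFin (rank C) y)) (s≤s⁻¹ M∸b<m)) vy≢0 y-black
          (rot-active C black vy≢0) (stays-white vz≢0 z-white) a-end
          (rot-cyc C black _ y (rot-active C black vy≢0) vy≢0 (trans a-end (sym y-own)))
          where
          y = rot C white z
          vy≢0 : val y ≢ 0
          vy≢0 = rot-active C white vz≢0
          y-own : end C black y ≡ just y
          y-own = trans (cong (λ c → end C c y) (sym y-black)) (own C y)
          a-end : end C black (face C z) ≡ just y
          a-end = trans (rot-end C black y) y-own
          y-parent : end C (opp (col y)) y ≡ just z
          y-parent = trans (cong (λ c → end C (opp c) y) y-black)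
            (trans (rot-end C white z) (trans (cong (λ c → end C c z) (sym z-white)) (own C z)))
          z-parent : end C (opp (col z)) z ≡ just b
          z-parent = trans (cong (λ c → end C (opp c) z) z-white) z-end
          b<y : rank C b < rank C y
          b<y = <-trans (ranked C z b vz≢0 z-parent) (ranked C y z vy≢0 y-parent)

      -- A white letter `x` would have an active black end `b`, and going around `b` from the edge
      -- `x` up to the edge `b` starts the endless ascent. So without a peak every active letter is
      -- black, and the tree is a star around the root.
      flat-black : ∀ x → val x ≢ 0 → col x ≡ black
      flat-black x vx≢0 with same-or-opp (col x) white
      ... | inj₂ x-black = x-black
      ... | inj₁ x-white with end C black x in x-end
      ...   | nothing = contradiction x-end (rooted C x)
      ...   | just b = ⊥-elim (ascend _ b x ≤-refl vb≢0 b-black vx≢0 x-white x-end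
        (rot-cyc C black x b vx≢0 vb≢0 (trans x-end (sym (trans (cong (λ c → end C c b) (sym b-black)) (own C b))))))
        where
        b-black : col b ≡ black
        b-black = typed C black x b x-end
        vb≢0 : val b ≢ 0
        vb≢0 = end-active C black (wt-pos C x vx≢0) x-end

      flat-black-rot : ∀ x → rot C black x ≡ x
      flat-black-rot x with val x ℕ.≟ 0
      ... | yes vx≡0 = rot-fix C black x vx≡0
      ... | no vx≢0  = sym (same-colour-end
        (trans (cong (λ c → end C c x) x-black) (trans (sym (rot-end C black x)) (cong (λ c → end C c (rot C black x)) (sym x-black))))
        (trans (flat-black _ (rot-active C black vx≢0)) (sym x-black)))
        where
        x-black : col x ≡ black
        x-black = flat-black x vx≢0

      flat-face : face C ≗ rot C white
      flat-face x = flat-black-rot (rot C white x)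

      flat-white-end : ∀ x → val x ≢ 0 → end C white x ≡ nothing
      flat-white-end x vx≢0 with end C white x in eq
      ... | nothing = refl
      ... | just a  = contradiction
        (trans (sym (typed C white x a eq)) (flat-black a (end-active C white (wt-pos C x vx≢0) eq))) λ ()

      flat-wt : ∀ x → val x ≢ 0 → wt C x ≡ val x
      flat-wt x vx≢0 = sole-wt C others
        where
        others : ∀ z → z ≢ x → end C (col x) z ≡ just x → wt C z ≡ 0
        others z z≢x eq with val z ℕ.≟ 0
        ... | yes vz≡0 = wt-zero C z vz≡0
        ... | no vz≢0  = contradiction
          (sym (same-colour-end (trans (own C x) (sym eq)) (trans (flat-black z vz≢0) (sym (flat-black x vx≢0))))) z≢x

  -- The face permutation is cyclic and determines the tree

  -- A plane tree has a single face. At a peak the leaf and its parent are consecutive in the face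
  -- permutation, so the single orbit of the pruned tree lifts and takes in the leaf. For a star the
  -- face permutation is the rotation around the root.
  face-transitive : ∀ m {r val} → colourSum col white (const true) val < m → (C : Coded r val) →
                    ∀ x y → val x ≢ 0 → val y ≢ 0 → Orbit (face C) x y
  face-transitive (suc m) {r} {val} W<m C x y vx≢0 vy≢0 with peak? val (face C)
  ... | no flat = orbit-cong (λ z → sym (flat-face C flat z))
    (rot-cyc C white x y vx≢0 vy≢0 (trans (flat-white-end C flat x vx≢0) (sym (flat-white-end C flat y vy≢0))))
  ... | yes (v , (vv≢0 , v-white) , Nv-black) =
    let a , b , leaf , a→b = some-leaf
        x′ , vx′≢0 , x→x′ = link leaf a→b x vx≢0
        y′ , vy′≢0 , y→y′ = link leaf a→b y vy≢0
        W′<m = <-≤-trans (white-decreases col (leaf-opposite C leaf) (leaf<parent C leaf) (Leaf.active leaf)) (s≤s⁻¹ W<m)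
        x′→y′ = face-transitive m W′<m (prune C leaf) x′ y′ vx′≢0 vy′≢0
    in orbit-trans x→x′ (orbit-trans (orbit-unskip (face-inj C) a (orbit-cong (face-prune C leaf) x′→y′))
         (orbit-sym (face-inj C) y→y′))
    where
    some-leaf : ∃₂ λ a b → Leaf C a b × Orbit (face C) a b
    some-leaf with peak-leaf C vv≢0 v-white Nv-black refl
    ... | inj₁ (leaf , _) = v , face C v , leaf , step here
    -- Here the leaf comes right after its parent, so the parent is reached by going around the
    -- cycle.
    ... | inj₂ (leaf , _) = face C v , v , leaf , orbit-return (face-inj C) v

    -- The leaf becomes inactive by pruning; its parent, active and in the same face orbit, stands
    -- in for it.
    link : ∀ {a b} → Leaf C a b → Orbit (face C) a b → ∀ z → val z ≢ 0 →
           ∃ λ w → reduce a b val w ≢ 0 × Orbit (face C) z w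
    link {a} {b} leaf a→b z vz≢0 with z ≟ a
    ... | yes refl = b , reduce-parent≢0 a b val (leaf≢parent C leaf) (leaf<parent C leaf) , a→b
    ... | no z≢a   = z , inactive′ C leaf z≢a vz≢0 , here

  -- The ends of letters of weight 0 are arbitrary leftovers, hence the restriction in `same-end`.
  record Same {r val} (C D : Coded r val) : Set where
    field
      same-rot : ∀ c → rot C c ≗ rot D c
      same-wt  : wt C ≗ wt D
      same-end : ∀ c x → val x ≢ 0 → end C c x ≡ end D c x
  open Same

  -- Pruning loses just the place of `x` around its parent, which the last hypothesis supplies; at
  -- its own colour `x` is a fixed point in both trees.
  prune-same : ∀ {r val} (C D : Coded r val) {x y} (lC : Leaf C x y) (lD : Leaf D x y) →
               Same (prune C lC) (prune D lD) → rot C (opp (col x)) ≗ rot D (opp (col x)) → Same C D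
  prune-same {r} {val} C D {x} {y} lC lD same rot≗ = record
    { same-rot = rots ; same-wt = λ z → wts z (z ≟ x) ; same-end = λ c z vz≢0 → ends c z vz≢0 (z ≟ x) }
    where
    rots : ∀ c → rot C c ≗ rot D c
    rots c z with same-or-opp c (col x)
    ... | inj₁ refl = trans (sym (skip-fixed (Leaf.alone lC) z))
      (trans (same-rot same (col x) z) (skip-fixed (Leaf.alone lD) z))
    ... | inj₂ refl = rot≗ z
    wts : ∀ z → Dec (z ≡ x) → wt C z ≡ wt D z
    wts z (yes refl) = trans (leaf-wt C lC) (sym (leaf-wt D lD))
    wts z (no z≢x) = trans (sym (if-no (z ≟ x) z≢x)) (trans (same-wt same z) (if-no (z ≟ x) z≢x))
    ends : ∀ c z → val z ≢ 0 → Dec (z ≡ x) → end C c z ≡ end D c z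
    ends c z vz≢0 (no z≢x) = same-end same c z (inactive′ C lC z≢x vz≢0)
    ends c z vz≢0 (yes refl) with same-or-opp c (col z)
    ... | inj₁ refl = trans (own C z) (sym (own D z))
    ... | inj₂ refl = trans (Leaf.attached lC) (sym (Leaf.attached lD))

  face-determines : ∀ m {r val} → colourSum col white (const true) val < m →
                    (C D : Coded r val) → face C ≗ face D → Same C D
  face-determines (suc m) {r} {val} W<m C D N≗ with peak? val (face C)
  ... | no flat = record { same-rot = rots ; same-wt = wts ; same-end = ends }
    where
    flat′ : ¬ Peak val (face D)
    flat′ (v , v-white , Nv-black) = flat (v , v-white , trans (cong col (N≗ v)) Nv-black)
    rots : ∀ c → rot C c ≗ rot D c
    rots white z = trans (sym (flat-face C flat z)) (trans (N≗ z) (flat-face D flat′ z))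
    rots black z = trans (flat-black-rot C flat z) (sym (flat-black-rot D flat′ z))
    wts : wt C ≗ wt D
    wts z with val z ℕ.≟ 0
    ... | yes vz≡0 = trans (wt-zero C z vz≡0) (sym (wt-zero D z vz≡0))
    ... | no vz≢0  = trans (flat-wt C flat z vz≢0) (sym (flat-wt D flat′ z vz≢0))
    ends : ∀ c z → val z ≢ 0 → end C c z ≡ end D c z
    ends white z vz≢0 = trans (flat-white-end C flat z vz≢0) (sym (flat-white-end D flat′ z vz≢0))
    ends black z vz≢0 = subst (λ c → end C c z ≡ end D c z) (flat-black C flat z vz≢0) (trans (own C z) (sym (own D z)))
  ... | yes (v , (vv≢0 , v-white) , Nv-black)
    with peak-leaf C vv≢0 v-white Nv-black refl | peak-leaf D vv≢0 v-white Nv-black (sym (N≗ v))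
  -- Opposite choices would make `v` both lighter and heavier than its successor.
  ...   | inj₁ (lC , _) | inj₂ (lD , _) = contradiction (leaf<parent D lD) (<-asym (leaf<parent C lC))
  ...   | inj₂ (lC , _) | inj₁ (lD , _) = contradiction (leaf<parent D lD) (<-asym (leaf<parent C lC))
  -- Around its parent the leaf `v` has the same successor in both trees, which suffices to undo the
  -- bypass.
  ...   | inj₁ (lC , αC) | inj₁ (lD , αD) = prune-same C D lC lD same
    (subst (λ c → rot C (opp c) ≗ rot D (opp c)) (sym v-white)
      (skip-determines (same-rot same black) (trans αC (sym αD))))
    where
    same : Same (prune C lC) (prune D lD)
    same = face-determines m (<-≤-trans (white-decreases col (leaf-opposite C lC) (leaf<parent C lC) vv≢0) (s≤s⁻¹ W<m))
      (prune C lC) (prune D lD) λ z → trans (face-prune C lC z) (trans (skip-cong v N≗ z) (sym (face-prune D lD z)))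
  -- Now the predecessor of the leaf is known: around the parent `v` it is the edge `v`.
  ...   | inj₂ (lC , σC) | inj₂ (lD , σD) = prune-same C D lC lD same
    (subst (λ c → rot C (opp c) ≗ rot D (opp c)) (sym Nv-black)
      (skip-determines′ (same-rot same white) σC σD))
    where
    same : Same (prune C lC) (prune D lD)
    same = face-determines m (<-≤-trans (white-decreases col (leaf-opposite C lC) (leaf<parent C lC) (Leaf.active lC)) (s≤s⁻¹ W<m))
      (prune C lC) (prune D lD) λ z → trans (face-prune C lC z) (trans (skip-cong (face C v) N≗ z) (sym (face-prune D lD z)))

  -- Grafting a leaf

  module _ {r : ℕ} {val : X → ℕ} {x y : X} (C : Coded r (reduce x y val))
           (vx≢0 : val x ≢ 0) (x<y : val x < val y) (opposite : col y ≡ opp (col x))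
           {ρ : X → X} (ρ-inj : Injective _≡_ _≡_ ρ) (ρ-skip : skip x ρ ≗ rot C (opp (col x)))
           (ρ-end : end C (opp (col x)) (ρ x) ≡ just y) (ρ≢x : ρ x ≢ x) (ρ-link : Orbit ρ x y)
           (ρ-fix : ∀ z → val z ≡ 0 → ρ z ≡ z)
    where

    private
      val′ = reduce x y val

      c° = opp (col x)

      c°≢ : c° ≢ col x
      c°≢ = opp-≢ (col x)

      x≢y : x ≢ y
      x≢y refl = c°≢ (sym opposite)

      val′x≡0 : val′ x ≡ 0
      val′x≡0 = reduce-leaf x y val

      val′≢0 : ∀ {z} → z ≢ x → val z ≢ 0 → val′ z ≢ 0
      val′≢0 z≢x vz≢0 v′z≡0 = vz≢0 (reduce≡0 x y val x≢y x<y v′z≡0 z≢x)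

      val′y≢0 : val′ y ≢ 0
      val′y≢0 = reduce-parent≢0 x y val x≢y x<y

      rot″ : Colour → X → X
      rot″ c z = if does (c ≟ᶜ col x) then rot C c z else ρ z

      end″ : Colour → X → Maybe X
      end″ c z = if does (z ≟ x) then (if does (c ≟ᶜ col x) then just x else just y) else end C c z

      wt″ rank″ : X → ℕ
      wt″ z = if does (z ≟ x) then val x else wt C z
      -- One more than the parent is enough: no active letter hangs at the new leaf, so the other
      -- ranks need not move.
      rank″ z = if does (z ≟ x) then suc (rank C y) else rank C z

      rot-own : ∀ z → rot″ (col x) z ≡ rot C (col x) z
      rot-own z = if-yes (col x ≟ᶜ col x) refl

      rot-opp : ∀ z → rot″ c° z ≡ ρ z
      rot-opp z = if-no (c° ≟ᶜ col x) c°≢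

      end-own : end″ (col x) x ≡ just x
      end-own = trans (if-yes (x ≟ x) refl) (if-yes (col x ≟ᶜ col x) refl)

      end-opp : end″ c° x ≡ just y
      end-opp = trans (if-yes (x ≟ x) refl) (if-no (c° ≟ᶜ col x) c°≢)

      end-other : ∀ c {z} → z ≢ x → end″ c z ≡ end C c z
      end-other c {z} z≢x = if-no (z ≟ x) z≢x

      wt-x : wt″ x ≡ val x
      wt-x = if-yes (x ≟ x) refl

      wt-other : ∀ {z} → z ≢ x → wt″ z ≡ wt C z
      wt-other {z} z≢x = if-no (z ≟ x) z≢x

      rank-x : rank″ x ≡ suc (rank C y)
      rank-x = if-yes (x ≟ x) refl

      rank-other : ∀ {z} → z ≢ x → rank″ z ≡ rank C z
      rank-other {z} z≢x = if-no (z ≟ x) z≢x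

      -- Before grafting `x` has weight 0, and an edge of positive weight cannot end at such a
      -- vertex. This is what makes the new letter a leaf.
      not-to-x : ∀ c z → val′ z ≢ 0 → end C c z ≢ just x
      not-to-x c z v′z≢0 eq = end-active C c (wt-pos C z v′z≢0) eq val′x≡0

      rot-C-x : rot C (col x) x ≡ x
      rot-C-x = rot-fix C (col x) x val′x≡0

      -- If `x` is inserted right after `z`, then `z` was followed in `C` by `ρ x`, whose end is
      -- `y`; hence `z` ends at `y` as well.
      ρ-end-other : ∀ z → z ≢ x → end″ c° (ρ z) ≡ end C c° z
      ρ-end-other z z≢x with ρ z ≟ x
      ... | yes ρz≡x = trans (if-no (c° ≟ᶜ col x) c°≢) (begin
        just y                    ≡⟨ ρ-end ⟨
        end C c° (ρ x)            ≡⟨ cong (end C c°) (skip-into ρ ρz≡x) ⟨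
        end C c° (skip x ρ z)     ≡⟨ cong (end C c°) (ρ-skip z) ⟩
        end C c° (rot C c° z)     ≡⟨ rot-end C c° z ⟩
        end C c° z                ∎)
        where open ≡-Reasoning
      ... | no ρz≢x = begin
        end C c° (ρ z)            ≡⟨ cong (end C c°) (skip-other ρ-inj z≢x ρz≢x) ⟨
        end C c° (skip x ρ z)     ≡⟨ cong (end C c°) (ρ-skip z) ⟩
        end C c° (rot C c° z)     ≡⟨ rot-end C c° z ⟩
        end C c° z                ∎
        where open ≡-Reasoning

      degree-here : ∀ c {v} → end″ c x ≡ v → degree (end″ c) wt″ v ≡ degree (end C c) (wt C) v + val x
      degree-here c {v} eq = trans
        (degree-remove-here (end″ c) (end C c) wt″ (wt C) x (wt-zero C x val′x≡0)
          (λ _ → end-other c) (λ _ → wt-other) eq)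
        (cong (degree (end C c) (wt C) v +_) wt-x)

      degree-elsewhere : ∀ c {v} → end″ c x ≢ v → degree (end″ c) wt″ v ≡ degree (end C c) (wt C) v
      degree-elsewhere c = degree-remove-elsewhere (end″ c) (end C c) wt″ (wt C) x (wt-zero C x val′x≡0)
        (λ _ → end-other c) (λ _ → wt-other)

    -- The inverse of `prune`. The rotation at the colour of `y` becomes `ρ`, which has `x` inserted
    -- in the cycle around `y` and gives back the old rotation when `x` is bypassed. At its own
    -- colour `x` remains a fixed point.
    graft : Coded r val
    graft .rot = rot″
    graft .end = end″
    graft .wt = wt″
    graft .rank = rank″
    graft .rot-inj c {a} {b} eq with same-or-opp c (col x)
    ... | inj₁ refl = rot-inj C (col x) (trans (sym (rot-own a)) (trans eq (rot-own b)))
    ... | inj₂ refl = ρ-inj (trans (sym (rot-opp a)) (trans eq (rot-opp b)))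
    graft .rot-end c z with same-or-opp c (col x)
    ... | inj₁ refl = trans (cong (end″ (col x)) (rot-own z)) (go (z ≟ x))
      where
      go : Dec (z ≡ x) → end″ (col x) (rot C (col x) z) ≡ end″ (col x) z
      go (yes refl) = cong (end″ (col x)) rot-C-x
      go (no z≢x) = trans (end-other (col x) (λ eq → z≢x (rot-inj C (col x) (trans eq (sym rot-C-x)))))
        (trans (rot-end C (col x) z) (sym (end-other (col x) z≢x)))
    ... | inj₂ refl = trans (cong (end″ c°) (rot-opp z)) (go (z ≟ x))
      where
      go : Dec (z ≡ x) → end″ c° (ρ z) ≡ end″ c° z
      go (yes refl) = trans (end-other c° ρ≢x) (trans ρ-end (sym end-opp))
      go (no z≢x) = trans (ρ-end-other z z≢x) (sym (end-other c° z≢x))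
    graft .rot-cyc c z w vz≢0 vw≢0 eq with same-or-opp c (col x)
    ... | inj₁ refl = orbit-cong (λ a → sym (rot-own a)) (go (z ≟ x) (w ≟ x))
      where
      go : Dec (z ≡ x) → Dec (w ≡ x) → Orbit (rot C (col x)) z w
      go (yes refl) (yes refl) = here
      go (yes refl) (no w≢x) = contradiction (trans (sym (end-other (col x) w≢x)) (trans (sym eq) end-own))
        (not-to-x (col x) w (val′≢0 w≢x vw≢0))
      go (no z≢x) (yes refl) = contradiction (trans (sym (end-other (col x) z≢x)) (trans eq end-own))
        (not-to-x (col x) z (val′≢0 z≢x vz≢0))
      go (no z≢x) (no w≢x) = rot-cyc C (col x) z w (val′≢0 z≢x vz≢0) (val′≢0 w≢x vw≢0)
        (trans (sym (end-other (col x) z≢x)) (trans eq (end-other (col x) w≢x)))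
    ... | inj₂ refl = orbit-cong (λ a → sym (rot-opp a)) (go (z ≟ x) (w ≟ x))
      where
      lift : ∀ {a b} → Orbit (rot C c°) a b → Orbit ρ a b
      lift p = orbit-unskip ρ-inj x (orbit-cong (λ a → sym (ρ-skip a)) p)
      from-y : ∀ {a} → a ≢ x → val a ≢ 0 → just y ≡ end″ c° a → Orbit ρ y a
      from-y {a} a≢x va≢0 eq = lift (rot-cyc C c° y a val′y≢0 (val′≢0 a≢x va≢0)
        (trans (subst (λ d → end C d y ≡ just y) opposite (own C y)) (trans eq (end-other c° a≢x))))
      go : Dec (z ≡ x) → Dec (w ≡ x) → Orbit ρ z w
      go (yes refl) (yes refl) = here
      go (yes refl) (no w≢x) = orbit-trans ρ-link (from-y w≢x vw≢0 (trans (sym end-opp) eq))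
      go (no z≢x) (yes refl) = orbit-sym ρ-inj
        (orbit-trans ρ-link (from-y z≢x vz≢0 (trans (sym end-opp) (sym eq))))
      go (no z≢x) (no w≢x) = lift (rot-cyc C c° z w (val′≢0 z≢x vz≢0) (val′≢0 w≢x vw≢0)
        (trans (sym (end-other c° z≢x)) (trans eq (end-other c° w≢x))))
    graft .rot-fix c z vz≡0 with same-or-opp c (col x)
    ... | inj₁ refl = trans (rot-own z) (rot-fix C (col x) z (reduce-inactive x y val x<y vz≡0))
    ... | inj₂ refl = trans (rot-opp z) (ρ-fix z vz≡0)
    graft .own z = go (z ≟ x)
      where
      go : Dec (z ≡ x) → end″ (col z) z ≡ just z
      go (yes refl) = end-own
      go (no z≢x) = trans (end-other (col z) z≢x) (own C z)
    graft .typed c z w eq = go (z ≟ x)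
      where
      go : Dec (z ≡ x) → col w ≡ c
      go (no z≢x) = typed C c z w (trans (sym (end-other c z≢x)) eq)
      go (yes refl) with same-or-opp c (col x)
      ... | inj₁ refl = cong col (just-injective (trans (sym eq) end-own))
      ... | inj₂ refl = trans (cong col (just-injective (trans (sym eq) end-opp))) opposite
    graft .rooted z eq = go (z ≟ x)
      where
      go : Dec (z ≡ x) → ⊥
      go (no z≢x) = rooted C z (trans (sym (end-other black z≢x)) eq)
      go (yes refl) with same-or-opp black (col x)
      ... | inj₁ c≡ = contradiction (trans (sym eq) (trans (cong (λ c → end″ c z) c≡) end-own)) λ ()
      ... | inj₂ c≡ = contradiction (trans (sym eq) (trans (cong (λ c → end″ c z) c≡) end-opp)) λ ()
    graft .ranked z w vz≢0 eq = go (z ≟ x)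
      where
      go : Dec (z ≡ x) → rank″ w < rank″ z
      go (yes refl) with refl ← just-injective (trans (sym eq) end-opp) =
        subst (_≤ rank″ x) (cong suc (sym (rank-other (x≢y ∘ sym)))) (≤-reflexive (sym rank-x))
      go (no z≢x) = subst (_≤ rank″ z) (cong suc (sym (rank-other w≢x)))
        (subst (suc (rank C w) ≤_) (sym (rank-other z≢x)) (ranked C z w v′z≢0 eq′))
        where
        v′z≢0 : val′ z ≢ 0
        v′z≢0 = val′≢0 z≢x vz≢0
        eq′ : end C (opp (col z)) z ≡ just w
        eq′ = trans (sym (end-other _ z≢x)) eq
        w≢x : w ≢ x
        w≢x refl = not-to-x _ z v′z≢0 eq′
    graft .wt-zero z vz≡0 = trans (wt-other (λ { refl → vx≢0 vz≡0 })) (wt-zero C z (reduce-inactive x y val x<y vz≡0))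
    graft .wt-pos z vz≢0 = go (z ≟ x)
      where
      go : Dec (z ≡ x) → wt″ z ≢ 0
      go (yes refl) = vx≢0 ∘ trans (sym wt-x)
      go (no z≢x) = wt-pos C z (val′≢0 z≢x vz≢0) ∘ trans (sym (wt-other z≢x))
    graft .deg w = go (w ≟ x) (w ≟ y)
      where
      go : Dec (w ≡ x) → Dec (w ≡ y) → degree (end″ (col w)) wt″ (just w) ≡ val w
      go (yes refl) _ = trans (degree-here (col x) end-own) (cong (_+ val x) (trans (deg C x) val′x≡0))
      go (no _) (yes refl) = trans (degree-here (col y) (trans (cong (λ c → end″ c x) opposite) end-opp))
        (trans (cong (_+ val x) (deg C y)) (reduce-parent x y val x≢y x<y))
      go (no w≢x) (no w≢y) = trans (degree-elsewhere (col w) ne)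
        (trans (deg C w) (reduce-other x y val w≢x w≢y))
        where
        ne : end″ (col w) x ≢ just w
        ne eq with same-or-opp (col w) (col x)
        ... | inj₁ c≡ = w≢x (just-injective (trans (sym eq) (trans (cong (λ c → end″ c x) c≡) end-own)))
        ... | inj₂ c≡ = w≢y (just-injective (trans (sym eq) (trans (cong (λ c → end″ c x) c≡) end-opp)))
    graft .deg-root = trans (degree-elsewhere white ne) (deg-root C)
      where
      ne : end″ white x ≢ nothing
      ne eq with same-or-opp white (col x)
      ... | inj₁ c≡ = contradiction (trans (sym eq) (trans (cong (λ c → end″ c x) c≡) end-own)) λ ()
      ... | inj₂ c≡ = contradiction (trans (sym eq) (trans (cong (λ c → end″ c x) c≡) end-opp)) λ ()

    grafted : Σ (Coded r val) λ G → rot G (col x) ≗ rot C (col x) × rot G (opp (col x)) ≗ ρ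
    grafted = graft , rot-own , rot-opp

  -- The star around the root

  module _ {val : X → ℕ} (b : X) (b-black : col b ≡ black)
           (no-white : ∀ x → val x ≢ 0 → col x ≡ black) where

    private
      -- White letters all have weight 0 here, but `typed` and `rooted` still demand a black vertex
      -- as their black end; `b` is a placeholder for it.
      centre : Colour → Maybe X
      centre white = nothing
      centre black = just b

      star-end : Colour → X → Maybe X
      star-end c x = if does (col x ≟ᶜ c) then just x else centre c

      star-white : ∀ x → col x ≡ black → star-end white x ≡ nothing
      star-white x x-black = if-no (col x ≟ᶜ white) (λ x-white → contradiction (trans (sym x-white) x-black) λ ())

      star-black : ∀ x → col x ≡ black → star-end black x ≡ just x
      star-black x x-black = if-yes (col x ≟ᶜ black) x-black

    -- All active edges meet the root, so `N` itself is the rotation there and the black rotations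
    -- are trivial. Parents are the root, hence `ranked` is vacuous. With no active white letter,
    -- `balance` says that the black weights add up to `r`.
    star : ∀ {r} (N : X → X) → Injective _≡_ _≡_ N → (∀ x → val x ≡ 0 → N x ≡ x) →
           (∀ x y → val x ≢ 0 → val y ≢ 0 → Orbit N x y) →
           colourSum col white (const true) val + r ≡ colourSum col black (const true) val → Coded r val
    star N N-inj N-fix N-trans balance .rot white = N
    star N N-inj N-fix N-trans balance .rot black = id
    star N N-inj N-fix N-trans balance .end = star-end
    star N N-inj N-fix N-trans balance .wt = val
    star N N-inj N-fix N-trans balance .rank _ = 0
    star N N-inj N-fix N-trans balance .rot-inj white = N-inj
    star N N-inj N-fix N-trans balance .rot-inj black = id
    star N N-inj N-fix N-trans balance .rot-end black x = refl
    star N N-inj N-fix N-trans balance .rot-end white x with val x ℕ.≟ 0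
    ... | yes vx≡0 = cong (star-end white) (N-fix x vx≡0)
    ... | no vx≢0  = trans
      (star-white (N x) (no-white (N x) λ vNx≡0 → vx≢0 (trans (cong val (sym (N-inj (N-fix (N x) vNx≡0)))) vNx≡0)))
      (sym (star-white x (no-white x vx≢0)))
    star N N-inj N-fix N-trans balance .rot-cyc white x y vx≢0 vy≢0 _ = N-trans x y vx≢0 vy≢0
    star N N-inj N-fix N-trans balance .rot-cyc black x y vx≢0 vy≢0 eq = subst (Orbit id x)
      (just-injective (trans (sym (star-black x (no-white x vx≢0))) (trans eq (star-black y (no-white y vy≢0))))) here
    star N N-inj N-fix N-trans balance .rot-fix white = N-fix
    star N N-inj N-fix N-trans balance .rot-fix black _ _ = refl
    star N N-inj N-fix N-trans balance .own x = if-yes (col x ≟ᶜ col x) refl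
    star N N-inj N-fix N-trans balance .typed c x y eq with col x ≟ᶜ c
    star N N-inj N-fix N-trans balance .typed c x .x refl | yes x-c = x-c
    star N N-inj N-fix N-trans balance .typed black x .b refl | no _ = b-black
    star N N-inj N-fix N-trans balance .rooted x eq with col x ≟ᶜ black
    star N N-inj N-fix N-trans balance .rooted x () | yes _
    star N N-inj N-fix N-trans balance .rooted x () | no _
    star N N-inj N-fix N-trans balance .ranked x y vx≢0 eq = contradiction
      (trans (sym eq) (trans (cong (λ c → star-end (opp c) x) (no-white x vx≢0)) (star-white x (no-white x vx≢0)))) λ ()
    star N N-inj N-fix N-trans balance .wt-zero x vx≡0 = vx≡0
    star N N-inj N-fix N-trans balance .wt-pos x vx≢0 = vx≢0
    star N N-inj N-fix N-trans balance .deg y = trans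
      (sumFin-single {f = incidence (star-end (col y)) val (just y)} y zeros)
      (if-yes (star-end (col y) y ≟ᵛ just y) (if-yes (col y ≟ᶜ col y) refl))
      where
      zeros : ∀ z → z ≢ y → incidence (star-end (col y)) val (just y) z ≡ 0
      zeros z z≢y with val z ℕ.≟ 0
      ... | yes vz≡0 = if-0 (does (star-end (col y) z ≟ᵛ just y)) vz≡0
      ... | no vz≢0 with same-or-opp (col y) black
      ...   | inj₁ c≡ = if-no (star-end (col y) z ≟ᵛ just y) λ eq → z≢y (just-injective
        (trans (sym (star-black z (no-white z vz≢0))) (trans (cong (λ c → star-end c z) (sym c≡)) eq)))
      ...   | inj₂ c≡ = if-no (star-end (col y) z ≟ᵛ just y) λ eq → contradiction
        (trans (sym eq) (trans (cong (λ c → star-end c z) c≡) (star-white z (no-white z vz≢0)))) λ ()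
    star {r} N N-inj N-fix N-trans balance .deg-root = begin
      degree (star-end white) val nothing    ≡⟨ sumFin-cong terms ⟩
      colourSum col black (const true) val   ≡⟨ balance ⟨
      colourSum col white (const true) val + r ≡⟨ cong (_+ r) (sumFin-zero no-white-term) ⟩
      r ∎
      where
      open ≡-Reasoning
      no-white-term : ∀ z → colourTerm col white (const true) val z ≡ 0
      no-white-term z with val z ℕ.≟ 0
      ... | yes vz≡0 = if-0 (does (col z ≟ᶜ white)) vz≡0
      ... | no vz≢0  = if-no (col z ≟ᶜ white) λ z-white → contradiction (trans (sym z-white) (no-white z vz≢0)) λ ()
      terms : ∀ z → incidence (star-end white) val nothing z ≡ colourTerm col black (const true) val z
      terms z with val z ℕ.≟ 0
      ... | yes vz≡0 = trans (if-0 (does (star-end white z ≟ᵛ nothing)) vz≡0) (sym (if-0 (does (col z ≟ᶜ black)) vz≡0))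
      ... | no vz≢0  = trans (if-yes (star-end white z ≟ᵛ nothing) (star-white z (no-white z vz≢0)))
        (sym (if-yes (col z ≟ᶜ black) (no-white z vz≢0)))

  -- Realizing a cyclic permutation

  module _ {val : X → ℕ} {v g : X} (v-white : col v ≡ white) (g-black : col g ≡ black) (generic : Generic col val) where

    -- Otherwise the set consisting of `v` and `g` would be balanced.
    generic⇒≢ : val v ≢ 0 → val v ≢ val g
    generic⇒≢ vv≢0 vv≡vg = vv≢0 (generic P (trans white-sum (trans vv≡vg (sym black-sum))) v (if-yes (v ≟ v) refl))
      where
      P : X → Bool
      P z = if does (z ≟ v) then true else does (z ≟ g)
      v≢g : v ≢ g
      v≢g refl = contradiction (trans (sym v-white) g-black) λ ()
      off : ∀ c {z} → z ≢ v → z ≢ g → colourTerm col c P val z ≡ 0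
      off c {z} z≢v z≢g = cong (if_then (if does (col z ≟ᶜ c) then val z else 0) else 0)
        (trans (if-no (z ≟ v) z≢v) (dec-false (z ≟ g) z≢g))
      white-sum : colourSum col white P val ≡ val v
      white-sum = trans (sumFin-single v λ z z≢v → zeros z≢v (z ≟ g))
        (trans (colourTerm-on col P val v-white) (cong (if_then val v else 0) (if-yes (v ≟ v) refl)))
        where
        zeros : ∀ {z} → z ≢ v → Dec (z ≡ g) → colourTerm col white P val z ≡ 0
        zeros z≢v (yes refl) = colourTerm-off col P val λ g-white → contradiction (trans (sym g-white) g-black) λ ()
        zeros z≢v (no z≢g) = off white z≢v z≢g
      black-sum : colourSum col black P val ≡ val g
      black-sum = trans (sumFin-single g λ z z≢g → zeros z≢g (z ≟ v))
        (trans (colourTerm-on col P val g-black) (cong (if_then val g else 0)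
          (trans (if-no (g ≟ v) (v≢g ∘ sym)) (dec-true (g ≟ g) refl))))
        where
        zeros : ∀ {z} → z ≢ g → Dec (z ≡ v) → colourTerm col black P val z ≡ 0
        zeros z≢g (yes refl) = colourTerm-off col P val λ v-black → contradiction (trans (sym v-white) v-black) λ ()
        zeros z≢g (no z≢v) = off black z≢v z≢g

  record Cyclic (val : X → ℕ) (N : X → X) : Set where
    field
      injective  : Injective _≡_ _≡_ N
      fixed      : ∀ x → val x ≡ 0 → N x ≡ x
      transitive : ∀ x y → val x ≢ 0 → val y ≢ 0 → Orbit N x y
  open Cyclic

  module _ {val : X → ℕ} {x y : X} (x≢y : x ≢ y) (x<y : val x < val y) where

    skip-cyclic : ∀ {N} → Cyclic val N → Cyclic (reduce x y val) (skip x N)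
    skip-cyclic cyc .injective = skip-injective x (injective cyc)
    skip-cyclic {N} cyc .fixed z v′z≡0 = go (z ≟ x)
      where
      go : Dec (z ≡ x) → skip x N z ≡ z
      go (yes refl) = skip-self x N
      go (no z≢x) = trans (skip-other (injective cyc) z≢x (z≢x ∘ trans (sym Nz≡z))) Nz≡z
        where
        Nz≡z : N z ≡ z
        Nz≡z = fixed cyc z (reduce≡0 x y val x≢y x<y v′z≡0 z≢x)
    skip-cyclic cyc .transitive a b va≢0 vb≢0 = orbit-skip (injective cyc) (≢x va≢0) (≢x vb≢0)
      (transitive cyc a b (va≢0 ∘ reduce-inactive x y val x<y) (vb≢0 ∘ reduce-inactive x y val x<y))
      where
      ≢x : ∀ {z} → reduce x y val z ≢ 0 → z ≢ x
      ≢x v′z≢0 refl = v′z≢0 (reduce-leaf x y val)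

  Balanced : ℕ → (X → ℕ) → Set
  Balanced r val = colourSum col white (const true) val + r ≡ colourSum col black (const true) val

  reduce-balanced : ∀ {r val x y} → col y ≡ opp (col x) → val x < val y →
                    Balanced r val → Balanced r (reduce x y val)
  reduce-balanced {r} {val} {x} {y} opposite x<y balance = +-cancelʳ-≡ (val x) _ _ (begin
    W′ + r + val x   ≡⟨ +-assoc W′ r (val x) ⟩
    W′ + (r + val x) ≡⟨ cong (W′ +_) (+-comm r (val x)) ⟩
    W′ + (val x + r) ≡⟨ +-assoc W′ (val x) r ⟨
    W′ + val x + r   ≡⟨ cong (_+ r) (whole-reduce col opposite x<y white) ⟨
    colourSum col white (const true) val + r ≡⟨ balance ⟩
    colourSum col black (const true) val     ≡⟨ whole-reduce col opposite x<y black ⟩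
    colourSum col black (const true) (reduce x y val) + val x ∎)
    where
    open ≡-Reasoning
    W′ = colourSum col white (const true) (reduce x y val)

  Realized : ℕ → (X → ℕ) → (X → X) → Set
  Realized r val N = Σ (Coded r val) λ C → face C ≗ N

  module _ {r : ℕ} {val : X → ℕ} {N : X → X} (cyc : Cyclic val N)
           {v : X} (vv≢0 : val v ≢ 0) (v-white : col v ≡ white) (g-black : col (N v) ≡ black) where

    private
      g = N v

      v≢g : v ≢ g
      v≢g eq = contradiction (trans (sym v-white) (trans (cong col eq) g-black)) λ ()

      vg≢0 : val g ≢ 0
      vg≢0 vg≡0 = vv≢0 (trans (cong val (sym (injective cyc (fixed cyc g vg≡0)))) vg≡0)

      avoid : ∀ {w z} → val w ≢ 0 → val z ≡ 0 → z ≢ w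
      avoid vw≢0 vz≡0 refl = vw≢0 vz≡0

    -- `ρ` inserts `v` directly before `g` in the black rotation. The new face permutation is then
    -- `transpose v g` after `skip v N`, and the two transpositions cancel to leave `N`.
    graft-white : val v < val g → Realized r (reduce v g val) (skip v N) → Realized r val N
    graft-white v<g (C , C-face) = G , G-face
      where
      opposite : col g ≡ opp (col v)
      opposite = trans g-black (cong opp (sym v-white))
      α σ ρ : X → X
      α = rot C black
      σ = rot C white
      ρ z = transpose v g (α z)
      αv≡v : α v ≡ v
      αv≡v = rot-fix C black v (reduce-leaf v g val)
      ρv≡g : ρ v ≡ g
      ρv≡g = trans (cong (transpose v g) αv≡v) (transpose-left v g)
      ρ-skip : skip v ρ ≗ rot C (opp (col v))
      ρ-skip z = begin
        transpose v (ρ v) (ρ z)          ≡⟨ cong (λ w → transpose v w (ρ z)) ρv≡g ⟩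
        transpose v g (transpose v g (α z)) ≡⟨ transpose-involutive v g (α z) ⟩
        α z                              ≡⟨ cong (λ c → rot C (opp c) z) v-white ⟨
        rot C (opp (col v)) z            ∎
        where open ≡-Reasoning
      result : Σ (Coded r val) λ G → rot G (col v) ≗ rot C (col v) × rot G (opp (col v)) ≗ ρ
      result = grafted C vv≢0 v<g opposite {ρ} (rot-inj C black ∘ transpose-injective v g) ρ-skip
        (trans (cong₂ (end C) (sym opposite) ρv≡g) (own C g))
        (λ eq → v≢g (trans (sym eq) ρv≡g)) (orbit-≡ ρv≡g)
        (λ z vz≡0 → trans
          (cong (transpose v g) (rot-fix C black z (reduce-inactive v g val v<g vz≡0)))
          (transpose-other v g (avoid vv≢0 vz≡0) (avoid vg≢0 vz≡0)))
      G : Coded r val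
      G = proj₁ result
      G-white : rot G white ≗ σ
      G-white = subst (λ c → rot G c ≗ rot C c) v-white
        (proj₁ (proj₂ result))
      G-black : rot G black ≗ ρ
      G-black = subst (λ c → rot G (opp c) ≗ ρ) v-white
        (proj₂ (proj₂ result))
      G-face : face G ≗ N
      G-face z = begin
        rot G black (rot G white z)         ≡⟨ G-black (rot G white z) ⟩
        ρ (rot G white z)                   ≡⟨ cong ρ (G-white z) ⟩
        transpose v g (face C z)            ≡⟨ cong (transpose v g) (C-face z) ⟩
        transpose v g (transpose v g (N z)) ≡⟨ transpose-involutive v g (N z) ⟩
        N z                                 ∎
        where open ≡-Reasoning

    -- Here `ρ` inserts `g` directly after `v` in the white rotation, so the transposition is
    -- applied first. Conjugating it past `N` turns it into the one contained in `skip g N`, and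
    -- they cancel.
    graft-black : val g < val v → Realized r (reduce g v val) (skip g N) → Realized r val N
    graft-black g<v (C , C-face) = G , G-face
      where
      opposite : col v ≡ opp (col g)
      opposite = trans v-white (cong opp (sym g-black))
      α σ ρ : X → X
      α = rot C black
      σ = rot C white
      ρ z = σ (transpose v g z)
      σg≡g : σ g ≡ g
      σg≡g = rot-fix C white g (reduce-leaf g v val)
      ρg≡σv : ρ g ≡ σ v
      ρg≡σv = cong σ (transpose-right v g)
      ρv≡g : ρ v ≡ g
      ρv≡g = trans (cong σ (transpose-left v g)) σg≡g
      ρ-inj : Injective _≡_ _≡_ ρ
      ρ-inj = transpose-injective v g ∘ rot-inj C white
      ρ-skip : skip g ρ ≗ rot C (opp (col g))
      ρ-skip z = begin
        transpose g (ρ g) (ρ z)                ≡⟨ cong₂ (λ a b → transpose a b (ρ z)) (sym σg≡g) ρg≡σv ⟩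
        transpose (σ g) (σ v) (ρ z)            ≡⟨ transpose-conj (rot-inj C white) g v (transpose v g z) ⟨
        σ (transpose g v (transpose v g z))    ≡⟨ cong σ (transpose-inverse g v) ⟩
        σ z                                    ≡⟨ cong (λ c → rot C (opp c) z) g-black ⟨
        rot C (opp (col g)) z                  ∎
        where open ≡-Reasoning
      ρ-end : end C (opp (col g)) (ρ g) ≡ just v
      ρ-end = begin
        end C (opp (col g)) (ρ g) ≡⟨ cong₂ (λ c w → end C (opp c) w) g-black ρg≡σv ⟩
        end C white (σ v)         ≡⟨ rot-end C white v ⟩
        end C white v             ≡⟨ cong (λ c → end C c v) v-white ⟨
        end C (col v) v           ≡⟨ own C v ⟩
        just v                    ∎
        where open ≡-Reasoning
      result : Σ (Coded r val) λ G → rot G (col g) ≗ rot C (col g) × rot G (opp (col g)) ≗ ρ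
      result = grafted C vg≢0 g<v opposite {ρ} ρ-inj ρ-skip ρ-end
        (λ eq → v≢g (rot-inj C white (trans (sym ρg≡σv) (trans eq (sym σg≡g)))))
        (orbit-sym ρ-inj (orbit-≡ ρv≡g))
        (λ z vz≡0 → trans
          (cong σ (transpose-other v g (avoid vv≢0 vz≡0) (avoid vg≢0 vz≡0)))
          (rot-fix C white z (reduce-inactive g v val g<v vz≡0)))
      G : Coded r val
      G = proj₁ result
      G-black : rot G black ≗ α
      G-black = subst (λ c → rot G c ≗ rot C c) g-black
        (proj₁ (proj₂ result))
      G-white : rot G white ≗ ρ
      G-white = subst (λ c → rot G (opp c) ≗ ρ) g-black
        (proj₂ (proj₂ result))
      G-face : face G ≗ N
      G-face z = begin
        rot G black (rot G white z)                   ≡⟨ G-black (rot G white z) ⟩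
        α (rot G white z)                             ≡⟨ cong α (G-white z) ⟩
        face C (transpose v g z)                      ≡⟨ C-face (transpose v g z) ⟩
        transpose g (N g) (N (transpose v g z))       ≡⟨ cong (transpose g (N g)) (transpose-conj (injective cyc) v g z) ⟩
        transpose g (N g) (transpose g (N g) (N z))   ≡⟨ transpose-involutive g (N g) (N z) ⟩
        N z                                           ∎
        where open ≡-Reasoning

  -- Without a peak, `N` keeps an active white letter white forever, while transitivity would take
  -- it to a black letter; so no active letter is white and the star applies. At a peak, genericity
  -- excludes equal weights and the lighter of the two letters becomes the leaf.
  realize : ∀ m {r val N} → colourSum col white (const true) val < m → r ≢ 0 → Balanced r val →
            Generic col val → Cyclic val N → Realized r val N
  realize (suc m) {r} {val} {N} W<m r≢0 balance generic cyc with peak? val N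
  ... | no flat = star b b-black no-white N (injective cyc) (fixed cyc) (transitive cyc) balance , λ _ → refl
    where
    -- The black total exceeds the white one by `r`, which is nonzero.
    some-black : ∃ λ b → colourTerm col black (const true) val b ≢ 0
    some-black = sumFin-positive _ λ B≡0 → r≢0 (m+n≡0⇒n≡0 (colourSum col white (const true) val) (trans balance B≡0))
    b = proj₁ some-black
    b-black : col b ≡ black
    b-black = if≢0⇒ (col b ≟ᶜ black) (proj₂ some-black)
    vb≢0 : val b ≢ 0
    vb≢0 vb≡0 = proj₂ some-black (if-0 (does (col b ≟ᶜ black)) vb≡0)
    stays-white : ∀ {x y} → Orbit N x y → val x ≢ 0 → col x ≡ white → col y ≡ white
    stays-white here _ x-white = x-white
    stays-white {x} (step p) vx≢0 x-white with same-or-opp (col (N x)) white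
    ... | inj₁ Nx-white = stays-white p
      (λ vNx≡0 → vx≢0 (trans (cong val (sym (injective cyc (fixed cyc (N x) vNx≡0)))) vNx≡0)) Nx-white
    ... | inj₂ Nx-black = contradiction (x , (vx≢0 , x-white) , Nx-black) flat
    no-white : ∀ x → val x ≢ 0 → col x ≡ black
    no-white x vx≢0 with same-or-opp (col x) black
    ... | inj₁ x-black = x-black
    ... | inj₂ x-white = contradiction
      (trans (sym (stays-white (transitive cyc x b vx≢0 vb≢0) vx≢0 x-white)) b-black) λ ()
  ... | yes (v , (vv≢0 , v-white) , g-black) with <-cmp (val v) (val (N v))
  ...   | tri≈ _ vv≡vg _ = contradiction vv≡vg (generic⇒≢ v-white g-black generic vv≢0)
  ...   | tri< v<g _ _ = graft-white cyc vv≢0 v-white g-black v<g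
    (realize m (<-≤-trans (white-decreases col opposite v<g vv≢0) (s≤s⁻¹ W<m)) r≢0
      (reduce-balanced opposite v<g balance) (reduce-generic col opposite v<g generic)
      (skip-cyclic (λ v≡g → opp-≢ (col v) (trans (sym opposite) (sym (cong col v≡g)))) v<g cyc))
    where
    opposite : col (N v) ≡ opp (col v)
    opposite = trans g-black (cong opp (sym v-white))
  ...   | tri> _ _ g<v = graft-black cyc vv≢0 v-white g-black g<v
    (realize m (<-≤-trans (white-decreases col opposite g<v vg≢0) (s≤s⁻¹ W<m)) r≢0
      (reduce-balanced opposite g<v balance) (reduce-generic col opposite g<v generic)
      (skip-cyclic (λ g≡v → opp-≢ (col (N v)) (trans (sym opposite) (sym (cong col g≡v)))) g<v cyc))
    where
    opposite : col v ≡ opp (col (N v))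
    opposite = trans v-white (cong opp (sym g-black))
    vg≢0 : val (N v) ≢ 0
    vg≢0 vg≡0 = vv≢0 (trans (cong val (sym (injective cyc (fixed cyc (N v) vg≡0)))) vg≡0)

  -- Rigidity of the naming of edges

  -- If q x were not the edge of x towards the root, it would be the edge of a vertex of larger rank,
  -- which by induction has chosen that edge itself.
  incident⇒id : ∀ {r val} (C : Coded r val) → (∀ x → val x ≢ 0) → (q : X → X) → Injective _≡_ _≡_ q →
                (∀ x → end C (col x) (q x) ≡ just x) → q ≗ id
  incident⇒id {val = val} C active q q-inj q-end x = go _ x ≤-refl
    where
    M = sumFin n (rank C)
    go : ∀ m x → M ∸ rank C x < m → q x ≡ x
    go (suc m) x M∸x<m with q x ≟ x
    ... | yes qx≡x = qx≡x
    ... | no qx≢x with same-or-opp (col (q x)) (col x)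
    ...   | inj₁ same = contradiction
      (just-injective (trans (sym (own C (q x))) (trans (cong (λ c → end C c (q x)) same) (q-end x)))) qx≢x
    ...   | inj₂ opposite = contradiction
      (q-inj (go m (q x) (<-≤-trans (∸-monoʳ-< x<qx (term≤sumFin (rank C) (q x))) (s≤s⁻¹ M∸x<m)))) qx≢x
      where
      x<qx : rank C x < rank C (q x)
      x<qx = ranked C (q x) x (active (q x))
        (trans (cong (λ c → end C c (q x)) (trans (cong opp opposite) (opp-opp (col x)))) (q-end x))

-- Enumeration of the cyclic permutations

record Cycle (n : ℕ) : Set where
  constructor cycle
  field
    next       : Fin n → Fin n
    next-inj   : Injective _≡_ _≡_ next
    next-orbit : ∀ x y → Orbit next x y
open Cycle

cycleSetoid : ℕ → Setoid 0ℓ 0ℓ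
cycleSetoid n = record
  { Carrier = Cycle n
  ; _≈_ = λ N M → next N ≗ next M
  ; isEquivalence = record
    { refl  = λ _ → refl
    ; sym   = λ N≗M x → sym (N≗M x)
    ; trans = λ N≗M M≗K x → trans (N≗M x) (M≗K x)
    }
  }

lift : ∀ {n} → (Fin n → Fin n) → Fin (suc n) → Fin (suc n)
lift f zero    = zero
lift f (suc i) = suc (f i)

lift-injective : ∀ {n} {f : Fin n → Fin n} → Injective _≡_ _≡_ f → Injective _≡_ _≡_ (lift f)
lift-injective f-inj {zero}  {zero}  eq = refl
lift-injective f-inj {suc x} {suc y} eq = cong suc (f-inj (suc-injective eq))

module _ {n : ℕ} (N : Cycle n) (j : Fin n) where

  private
    f : Fin (suc n) → Fin (suc n)
    f = lift (next N) ∘ transpose zero (suc j)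

    f-inj : Injective _≡_ _≡_ f
    f-inj = transpose-injective zero (suc j) ∘ lift-injective (next-inj N)

  insert-into : f (suc j) ≡ zero
  insert-into = cong (lift (next N)) (transpose-right zero (suc j))

  insert-skip : skip zero f ≗ lift (next N)
  insert-skip x = begin
    transpose zero (f zero) (f x)
      ≡⟨ cong (λ y → transpose zero y (f x)) (cong (lift (next N)) (transpose-left zero (suc j))) ⟩
    transpose (lift (next N) zero) (lift (next N) (suc j)) (f x)
      ≡⟨ transpose-conj (lift-injective (next-inj N)) zero (suc j) (transpose zero (suc j) x) ⟨
    lift (next N) (transpose zero (suc j) (transpose zero (suc j) x))
      ≡⟨ cong (lift (next N)) (transpose-involutive zero (suc j) x) ⟩
    lift (next N) x ∎
    where open ≡-Reasoning

  -- The old letters are shifted by one and `zero` is put between `suc j` and its successor.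
  insert : Cycle (suc n)
  insert = cycle f f-inj λ x y → orbit-trans (to-j x) (orbit-sym f-inj (to-j y))
    where
    to-j : ∀ x → Orbit f x (suc j)
    to-j zero    = orbit-sym f-inj (orbit-≡ insert-into)
    to-j (suc x) = orbit-unskip f-inj zero (orbit-cong (λ y → sym (insert-skip y))
      (orbit-map suc (λ _ → refl) (next-orbit N x j)))

-- `N` comes back by bypassing `zero`, and `j` as the predecessor of `zero`.
insert-injective : ∀ {n} {N M : Cycle n} {i j} → next (insert N i) ≗ next (insert M j) →
                   next N ≗ next M × i ≡ j
insert-injective {N = N} {M} {i} {j} eq =
  (λ x → suc-injective (trans (sym (insert-skip N i (suc x)))
    (trans (skip-cong zero eq (suc x)) (insert-skip M j (suc x))))) ,
  suc-injective (next-inj (insert M j) {suc i} {suc j} (trans (sym (eq (suc i))) (trans (insert-into N i) (sym (insert-into M j)))))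

insert-cong : ∀ {n} {N M : Cycle n} {i j} → next N ≗ next M → i ≡ j →
              next (insert N i) ≗ next (insert M j)
insert-cong {N = N} {M} {i} N≗M refl = skip-determines′ {y = suc i}
  (λ x → trans (insert-skip N i x) (trans (lift-cong x) (sym (insert-skip M i x)))) (insert-into N i) (insert-into M i)
  where
  lift-cong : lift (next N) ≗ lift (next M)
  lift-cong zero    = refl
  lift-cong (suc x) = cong suc (N≗M x)

delete : ∀ {n} (N : Cycle (suc (suc n))) → ∃₂ λ M j → next N ≗ next (insert M j)
delete {n} N with preimage (next-inj N) zero
-- There is a second letter, so a cyclic permutation cannot fix `zero`.
... | zero , eq = contradiction (orbit-fixed eq (next-orbit N zero (suc zero))) λ ()
... | suc j , eq = M , j , skip-determines′ {y = suc j}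
  (λ x → trans (skip≗lift x) (sym (insert-skip M j x))) eq (insert-into M j)
  where
  s = skip zero (next N)
  s-inj : Injective _≡_ _≡_ s
  s-inj = skip-injective zero (next-inj N)
  lower : ∀ x → ∃ λ y → s (suc x) ≡ suc y
  lower x with s (suc x) in eq
  ... | zero  = contradiction (s-inj (trans eq (sym (skip-self zero (next N))))) λ ()
  ... | suc y = y , refl
  f : Fin (suc n) → Fin (suc n)
  f = proj₁ ∘ lower
  skip≗lift : s ≗ lift f
  skip≗lift zero    = skip-self zero (next N)
  skip≗lift (suc x) = proj₂ (lower x)
  lower-orbit : ∀ {x y} → Orbit (lift f) (suc x) (suc y) → Orbit f x y
  lower-orbit here     = here
  lower-orbit (step p) = step (lower-orbit p)
  M : Cycle (suc n)
  M = cycle f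
    (λ {x} {y} eq → suc-injective (s-inj (trans (skip≗lift (suc x)) (trans (cong suc eq) (sym (skip≗lift (suc y)))))))
    (λ x y → lower-orbit (orbit-cong skip≗lift (orbit-skip (next-inj N) (λ ()) (λ ()) (next-orbit N (suc x) (suc y)))))

-- The one-letter cycle needs a case of its own, because an insertion requires an existing letter to
-- follow. Each further letter has as many places as there are letters before it, whence the
-- factorial.
cycles : ∀ n → List (Cycle n)
cycles zero          = cycle id id (λ ()) ∷ []
cycles (suc zero)    = cycle id id (λ { zero zero → here }) ∷ []
cycles (suc (suc n)) = cartesianProductWith insert (cycles (suc n)) (allFin (suc n))

length-cartesianProductWith : ∀ {A B C : Set} (f : A → B → C) xs ys →
                              length (cartesianProductWith f xs ys) ≡ length xs * length ys
length-cartesianProductWith f []       ys = refl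
length-cartesianProductWith f (x ∷ xs) ys = trans (length-++ (map (f x) ys))
  (cong₂ _+_ (length-map (f x) ys) (length-cartesianProductWith f xs ys))

length-cycles : ∀ n → length (cycles n) ≡ (n ∸ 1) !
length-cycles zero          = refl
length-cycles (suc zero)    = refl
length-cycles (suc (suc n)) = begin
  length (cartesianProductWith insert (cycles (suc n)) (allFin (suc n)))
    ≡⟨ length-cartesianProductWith insert (cycles (suc n)) (allFin (suc n)) ⟩
  length (cycles (suc n)) * length (allFin (suc n))
    ≡⟨ cong₂ _*_ (length-cycles (suc n)) (length-tabulate {n = suc n} id) ⟩
  n ! * suc n
    ≡⟨ *-comm (n !) (suc n) ⟩
  suc n * n ! ∎
  where open ≡-Reasoning

cycles-distinct : ∀ n → AllPairs (λ N M → ¬ (next N ≗ next M)) (cycles n)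
cycles-distinct zero          = All.[] ∷ []
cycles-distinct (suc zero)    = All.[] ∷ []
cycles-distinct (suc (suc n)) =
  Unique.cartesianProductWith⁺ (cycleSetoid (suc n)) (≡.setoid (Fin (suc n))) (cycleSetoid (suc (suc n)))
    insert (λ {N} {M} → insert-injective {N = N} {M}) (cycles-distinct (suc n)) (Unique≡.allFin⁺ (suc n))

cycles-complete : ∀ n (N : Cycle n) → Any (λ M → next N ≗ next M) (cycles n)
cycles-complete zero          N = Any.here λ ()
cycles-complete (suc zero)    N = Any.here λ { zero → fixed (next N zero) }
  where
  fixed : ∀ (x : Fin 1) → x ≡ zero
  fixed zero = refl
cycles-complete (suc (suc n)) N =
  let M , j , eq = delete N in
  Any.cartesianProductWith⁺ insert
    (λ {K} {i} M≗K j≡i x → trans (eq x) (insert-cong {N = M} {K} M≗K j≡i x))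
    (cycles-complete (suc n) M) (∈-allFin j)

-- Rearranging sums, subsets given by predicates, least witnesses

sumFin-sum : ∀ {n} (f : Fin n → ℕ) → sumFin n f ≡ Sum.sum f
sumFin-sum {zero}  f = refl
sumFin-sum {suc n} f = cong (f zero +_) (sumFin-sum (f ∘ suc))

sumFin-permute : ∀ {m n} (f : Fin n → ℕ) (p : Fin m → Fin n) (q : Fin n → Fin m) →
                 (∀ e → p (q e) ≡ e) → (∀ x → q (p x) ≡ x) → sumFin m (f ∘ p) ≡ sumFin n f
sumFin-permute f p q pq qp = trans (sumFin-sum (f ∘ p))
  (trans (sym (Sum.sum-permute f (permutation p q pq qp))) (sym (sumFin-sum f)))

sumFin-++ : ∀ m {n} (f : Fin (m + n) → ℕ) →
            sumFin (m + n) f ≡ sumFin m (λ i → f (i ↑ˡ n)) + sumFin n (λ j → f (m ↑ʳ j))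
sumFin-++ zero    f = refl
sumFin-++ (suc m) f = trans (cong (f zero +_) (sumFin-++ m (f ∘ suc))) (sym (+-assoc (f zero) _ _))

sumFin-mono : ∀ {n} {f g : Fin n → ℕ} → (∀ i → f i ≤ g i) → sumFin n f ≤ sumFin n g
sumFin-mono {zero}  f≤g = z≤n
sumFin-mono {suc n} f≤g = +-mono-≤ (f≤g zero) (sumFin-mono (f≤g ∘ suc))

if-≤ : ∀ (b : Bool) {k} → (if b then k else 0) ≤ k
if-≤ true  = ≤-refl
if-≤ false = z≤n

module _ {n : ℕ} (Q : Fin n → Bool) where

  ∈-tabulate⁺ : ∀ {i} → Q i ≡ true → i ∈ tabulate Q
  ∈-tabulate⁺ {i} Qi = lookup⇒[]= i (tabulate Q) (trans (lookup∘tabulate Q i) Qi)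

  ∈-tabulate⁻ : ∀ {i} → i ∈ tabulate Q → Q i ≡ true
  ∈-tabulate⁻ {i} i∈ = trans (sym (lookup∘tabulate Q i)) ([]=⇒lookup i∈)

  does-∈-tabulate : ∀ i → does (i ∈? tabulate Q) ≡ Q i
  does-∈-tabulate i with Q i in eq
  ... | true  = dec-true (i ∈? tabulate Q) (∈-tabulate⁺ eq)
  ... | false = dec-false (i ∈? tabulate Q) λ i∈ → contradiction (trans (sym eq) (∈-tabulate⁻ i∈)) λ ()

  subsetSum-tabulate : ∀ f → subsetSum (tabulate Q) f ≡ sumFin n (λ i → if Q i then f i else 0)
  subsetSum-tabulate f = sumFin-cong λ i → cong (if_then f i else 0) (does-∈-tabulate i)

  ∁-tabulate : ∀ {i} → Q i ≡ false → i ∈ ∁ (tabulate Q)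
  ∁-tabulate Qi = x∉p⇒x∈∁p λ i∈ → contradiction (trans (sym Qi) (∈-tabulate⁻ i∈)) λ ()

least : ∀ {P : ℕ → Set} (P? : ∀ m → Dec (P m)) m → P m → ∃ λ m → P m × ∀ j → P j → m ≤ j
least P? m p with P? 0
least P? m p | yes p0 = 0 , p0 , λ _ _ → z≤n
least P? zero p | no ¬p0 = contradiction p ¬p0
least P? (suc m) p | no ¬p0 with m′ , p′ , minimal ← least (P? ∘ suc) m p =
  suc m′ , p′ , λ { zero p0 → contradiction p0 ¬p0 ; (suc j) pj → s≤s (minimal j pj) }

surjective : ∀ {m n} → m ≡ n → {p : Fin m → Fin n} → Injective _≡_ _≡_ p → ∀ e → ∃ λ x → p x ≡ e
surjective refl = preimage

-- From coded trees to w-trees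

module Trees {s t : ℕ} (k : Fin (suc s) → ℕ) (l : Fin (suc t) → ℕ)
             (k-pos : ∀ i → 1 ≤ k i) (l-pos : ∀ j → 1 ≤ l j) where

  private
    -- The white vertex `zero` is the root and has no letter. This leaves one letter for each other
    -- vertex, which is also the number of edges.
    n = s + suc t

  col : Fin n → Colour
  col x = [ const white , const black ]′ (splitAt s x)

  val : Fin n → ℕ
  val x = [ k ∘ suc , l ]′ (splitAt s x)

  white-letter : Fin s → Fin n
  white-letter a = a ↑ˡ suc t

  black-letter : Fin (suc t) → Fin n
  black-letter b = s ↑ʳ b

  open Coding col
  open Coded

  Vertex : Colour → Set
  Vertex white = Fin (suc s)
  Vertex black = Fin (suc t)

  weight : ∀ c → Vertex c → ℕ
  weight white = k
  weight black = l

  weight-pos : ∀ c i → weight c i ≢ 0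
  weight-pos white i k≡0 = contradiction (subst (1 ≤_) k≡0 (k-pos i)) λ ()
  weight-pos black i l≡0 = contradiction (subst (1 ≤_) l≡0 (l-pos i)) λ ()

  encode : ∀ c → Vertex c → Maybe X
  encode white zero    = nothing
  encode white (suc a) = just (white-letter a)
  encode black b       = just (black-letter b)

  -- The value of `decode black` at a white vertex is irrelevant, and conversely.
  decode : ∀ c → Maybe X → Vertex c
  decode white nothing  = zero
  decode white (just x) = [ suc , const zero ]′ (splitAt s x)
  decode black nothing  = zero
  decode black (just x) = [ const zero , id ]′ (splitAt s x)

  decode-encode : ∀ c i → decode c (encode c i) ≡ i
  decode-encode white zero    = refl
  decode-encode white (suc a) = cong [ suc , const zero ]′ (splitAt-↑ˡ s a (suc t))
  decode-encode black b       = cong [ const zero , id ]′ (splitAt-↑ʳ s (suc t) b)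

  encode-injective : ∀ c {i j} → encode c i ≡ encode c j → i ≡ j
  encode-injective c {i} {j} eq = trans (sym (decode-encode c i)) (trans (cong (decode c) eq) (decode-encode c j))

  encode-typed : ∀ c i {y} → encode c i ≡ just y → col y ≡ c
  encode-typed white (suc a) refl = cong [ const white , const black ]′ (splitAt-↑ˡ s a (suc t))
  encode-typed black b       refl = cong [ const white , const black ]′ (splitAt-↑ʳ s (suc t) b)

  encode-letter : ∀ x → ∃ λ (i : Vertex (col x)) → encode (col x) i ≡ just x × weight (col x) i ≡ val x
  encode-letter x with splitAt s x in eq
  ... | inj₁ a = suc a , cong just (splitAt⁻¹-↑ˡ eq) , refl
  ... | inj₂ b = b , cong just (splitAt⁻¹-↑ʳ {s} eq) , refl

  active : ∀ x → val x ≢ 0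
  active x vx≡0 with i , _ , w≡v ← encode-letter x = weight-pos (col x) i (trans w≡v vx≡0)

  encode-decode : ∀ c u → (∀ y → u ≡ just y → col y ≡ c) → (c ≡ black → u ≢ nothing) → encode c (decode c u) ≡ u
  encode-decode white nothing  _ _ = refl
  encode-decode black nothing  _ rooted = contradiction refl (rooted refl)
  encode-decode c (just x) typed _ with refl ← typed x refl with i , eq , _ ← encode-letter x =
    trans (cong (encode (col x) ∘ decode (col x)) (sym eq)) (trans (cong (encode (col x)) (decode-encode (col x) i)) eq)

  module _ (C : Coded (k zero) val) where

    vertex : ∀ c → X → Vertex c
    vertex c e = decode c (end C c e)

    encode-vertex : ∀ c e → encode c (vertex c e) ≡ end C c e
    encode-vertex c e = encode-decode c (end C c e) (typed C c e) λ { refl → rooted C e }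

    degree-encode : ∀ c i → degree (end C c) (wt C) (encode c i) ≡ weight c i
    degree-encode white zero = deg-root C
    degree-encode c i with encode c i in eq
    degree-encode c i | just y with refl ← encode-typed c i eq with j , eq′ , w≡v ← encode-letter y =
      trans (deg C y) (trans (sym w≡v) (cong (weight c) (encode-injective c (trans eq′ (sym eq)))))
    degree-encode white zero | nothing = deg-root C

    vertex-cycle : ∀ c e e′ → vertex c e ≡ vertex c e′ → Orbit (rot C c) e e′
    vertex-cycle c e e′ eq = rot-cyc C c e e′ (active e) (active e′)
      (trans (sym (encode-vertex c e)) (trans (cong (encode c) eq) (encode-vertex c e′)))

    face-reach : ∀ {e e′} → Orbit (face C) e e′ → Reach (rot C white) (rot C black) e e′
    face-reach here     = here
    face-reach (step p) = viaσ (viaα (face-reach p))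

    toWTree : WTree k l
    toWTree .WTree.n = n
    toWTree .WTree.wv = vertex white
    toWTree .WTree.bv = vertex black
    toWTree .WTree.wt = wt C
    toWTree .WTree.wt-pos e = n≢0⇒n>0 (wt-pos C e (active e))
    toWTree .WTree.σ = rot C white
    toWTree .WTree.α = rot C black
    toWTree .WTree.σ-inj = rot-inj C white
    toWTree .WTree.α-inj = rot-inj C black
    toWTree .WTree.σ-fib e = cong (decode white) (rot-end C white e)
    toWTree .WTree.α-fib e = cong (decode black) (rot-end C black e)
    toWTree .WTree.σ-cyc e e′ eq = orbit⇒iter (vertex-cycle white e e′ eq)
    toWTree .WTree.α-cyc e e′ eq = orbit⇒iter (vertex-cycle black e e′ eq)
    toWTree .WTree.white-weight i = trans (sumFin-cong λ e → cong (if_then wt C e else 0)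
      (does-⇔ (mk⇔ (λ eq → trans (sym (encode-vertex white e)) (cong (encode white) eq))
                   (λ eq → encode-injective white (trans (encode-vertex white e) eq)))
        (vertex white e ≟ i) (end C white e ≟ᵛ encode white i)))
      (degree-encode white i)
    toWTree .WTree.black-weight i = trans (sumFin-cong λ e → cong (if_then wt C e else 0)
      (does-⇔ (mk⇔ (λ eq → trans (sym (encode-vertex black e)) (cong (encode black) eq))
                   (λ eq → encode-injective black (trans (encode-vertex black e) eq)))
        (vertex black e ≟ i) (end C black e ≟ᵛ encode black i)))
      (degree-encode black i)
    toWTree .WTree.edge-count = +-comm n 1
    -- A step of the face permutation is a step of `σ` followed by one of `α`, so connectedness
    -- follows from having a single face.
    toWTree .WTree.connected e e′ = face-reach (face-transitive _ ≤-refl C e e′ (active e) (active e′))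

  -- Distinct weights make `φ` and `ψ` the identity, so `π` preserves the ends of edges. By
  -- `incident⇒id` it is then the identity as well, and the rotations coincide.
  isotopic⇒face : Injective _≡_ _≡_ k → Injective _≡_ _≡_ l → (C D : Coded (k zero) val) →
                  Isotopic (toWTree C) (toWTree D) → face C ≗ face D
  isotopic⇒face k-inj l-inj C D iso x = trans (rot-black (rot C white x)) (cong (rot D black) (rot-white x))
    where
    open Isotopic iso
    end-π : ∀ c e → end D c (π e) ≡ end C c e
    end-π white e = trans (sym (encode-vertex D white (π e)))
      (trans (cong (encode white) (trans (π-wv e) (k-inj (φ-wt _)))) (encode-vertex C white e))
    end-π black e = trans (sym (encode-vertex D black (π e)))
      (trans (cong (encode black) (trans (π-bv e) (l-inj (ψ-wt _)))) (encode-vertex C black e))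
    π≗id : π ≗ id
    π≗id = incident⇒id D active π π-inj λ x → trans (end-π (col x) x) (own C x)
    rot-white : rot C white ≗ rot D white
    rot-white e = trans (sym (π≗id (rot C white e))) (trans (sym (π-σ e)) (cong (rot D white) (π≗id e)))
    rot-black : rot C black ≗ rot D black
    rot-black e = trans (sym (π≗id (rot C black e))) (trans (sym (π-α e)) (cong (rot D black) (π≗id e)))

  -- From w-trees to coded trees

  module _ (T : WTree k l) where

    private
      module T = WTree T
      E = Fin T.n

    edge-end : Colour → E → Maybe X
    edge-end white e = encode white (T.wv e)
    edge-end black e = encode black (T.bv e)

    edge-rot : Colour → E → E
    edge-rot white = T.σ
    edge-rot black = T.α

    edge-rot-inj : ∀ c → Injective _≡_ _≡_ (edge-rot c)
    edge-rot-inj white = T.σ-inj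
    edge-rot-inj black = T.α-inj

    edge-rot-end : ∀ c e → edge-end c (edge-rot c e) ≡ edge-end c e
    edge-rot-end white e = cong (encode white) (T.σ-fib e)
    edge-rot-end black e = cong (encode black) (T.α-fib e)

    edge-rot-cyc : ∀ c e e′ → edge-end c e ≡ edge-end c e′ → Orbit (edge-rot c) e e′
    edge-rot-cyc white e e′ eq with m , iter≡ ← T.σ-cyc e e′ (encode-injective white eq) = iter⇒orbit m iter≡
    edge-rot-cyc black e e′ eq with m , iter≡ ← T.α-cyc e e′ (encode-injective black eq) = iter⇒orbit m iter≡

    edge-typed : ∀ c e {y} → edge-end c e ≡ just y → col y ≡ c
    edge-typed white e = encode-typed white (T.wv e)
    edge-typed black e = encode-typed black (T.bv e)

    edge-degree : ∀ c i → sumFin T.n (λ e → if does (edge-end c e ≟ᵛ encode c i) then T.wt e else 0) ≡ weight c i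
    edge-degree white i = trans (sumFin-cong λ e → cong (if_then T.wt e else 0)
      (does-⇔ (mk⇔ (encode-injective white) (cong (encode white))) (edge-end white e ≟ᵛ encode white i) (T.wv e ≟ i)))
      (T.white-weight i)
    edge-degree black i = trans (sumFin-cong λ e → cong (if_then T.wt e else 0)
      (does-⇔ (mk⇔ (encode-injective black) (cong (encode black))) (edge-end black e ≟ᵛ encode black i) (T.bv e ≟ i)))
      (T.black-weight i)

    some-edge : ∀ c i → ∃ λ e → edge-end c e ≡ encode c i
    some-edge c i with e , ≢0 ← sumFin-positive _ (weight-pos c i ∘ trans (sym (edge-degree c i))) =
      e , if≢0⇒ (edge-end c e ≟ᵛ encode c i) ≢0

    -- Walks with `m` edges from the vertex `u` to the root, ignoring the cyclic orders. There are
    -- finitely many edges to try, so a shortest walk can be searched for.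
    Walk : ℕ → Maybe X → Set
    Walk zero    u = u ≡ nothing
    Walk (suc m) u = ∃ λ e → (edge-end white e ≡ u × Walk m (edge-end black e)) ⊎
                             (edge-end black e ≡ u × Walk m (edge-end white e))

    walk? : ∀ m u → Dec (Walk m u)
    walk? zero    u = u ≟ᵛ nothing
    walk? (suc m) u = any? λ e → ((edge-end white e ≟ᵛ u) ×-dec walk? m (edge-end black e)) ⊎-dec
                                 ((edge-end black e ≟ᵛ u) ×-dec walk? m (edge-end white e))

    Reached : Maybe X → Set
    Reached u = ∃ λ m → Walk m u

    reached-white : ∀ {e} → Reached (edge-end black e) → Reached (edge-end white e)
    reached-white {e} (m , w) = suc m , e , inj₁ (refl , w)

    reached-black : ∀ {e} → Reached (edge-end white e) → Reached (edge-end black e)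
    reached-black {e} (m , w) = suc m , e , inj₂ (refl , w)

    -- `σ` keeps the white end. `α` keeps the black end, so one walks across the old edge and back
    -- along the new one.
    reached-along : ∀ {e e′} → Reach T.σ T.α e e′ → Reached (edge-end white e) → Reached (edge-end white e′)
    reached-along here       w = w
    reached-along (viaσ p)   w = reached-along p (subst Reached (sym (edge-rot-end white _)) w)
    reached-along (viaα p)   w = reached-along p
      (reached-white (subst Reached (sym (edge-rot-end black _)) (reached-black w)))

    reached-edge : ∀ c e → Reached (edge-end c e)
    reached-edge white e with e₀ , eq ← some-edge white zero = reached-along (T.connected e₀ e) (0 , eq)
    reached-edge black e = reached-black (reached-edge white e)

    reached : ∀ x → Reached (just x)
    reached x with i , eq , _ ← encode-letter x with e , eq′ ← some-edge (col x) i =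
      subst Reached (trans eq′ eq) (reached-edge (col x) e)

    abstract
      shortest : ∀ x → ∃ λ m → Walk m (just x) × ∀ j → Walk j (just x) → m ≤ j
      shortest x = least (λ m → walk? m (just x)) (proj₁ (reached x)) (proj₂ (reached x))

    distance : X → ℕ
    distance x = proj₁ (shortest x)

    -- The far end is either a letter nearer to the root or the root itself, for which the second
    -- condition is void.
    TowardsRoot : X → E → Set
    TowardsRoot x e = edge-end (col x) e ≡ just x ×
                      ∀ y → edge-end (opp (col x)) e ≡ just y → distance y < distance x

    last-edge : ∀ x m c e → suc m ≤ distance x → edge-end c e ≡ just x → Walk m (edge-end (opp c) e) → TowardsRoot x e
    last-edge x m c e m<d eq w with refl ← edge-typed c e eq =
      eq , λ y eq′ → ≤-trans (s≤s (proj₂ (proj₂ (shortest y)) m (subst (Walk m) eq′ w))) m<d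

    abstract
      -- The first edge of a shortest walk works: what remains of the walk bounds the distance of
      -- its far end. A walk of length 0 would start at the root, which is not a letter.
      towards-root : ∀ x → ∃ (TowardsRoot x)
      towards-root x = go (distance x) ≤-refl (proj₁ (proj₂ (shortest x)))
        where
        go : ∀ m → m ≤ distance x → Walk m (just x) → ∃ (TowardsRoot x)
        go (suc m) m<d (e , inj₁ (eq , w)) = e , last-edge x m white e m<d eq w
        go (suc m) m<d (e , inj₂ (eq , w)) = e , last-edge x m black e m<d eq w

    edge-of : X → E
    edge-of x = proj₁ (towards-root x)

    edge-of-own : ∀ x → edge-end (col x) (edge-of x) ≡ just x
    edge-of-own x = proj₁ (proj₂ (towards-root x))

    edge-of-parent : ∀ x y → edge-end (opp (col x)) (edge-of x) ≡ just y → distance y < distance x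
    edge-of-parent x = proj₂ (proj₂ (towards-root x))

    -- Two vertices of opposite colours with the same chosen edge would each be nearer to the root
    -- than the other; for equal colours the edge has one end of that colour.
    edge-of-injective : Injective _≡_ _≡_ edge-of
    edge-of-injective {x} {y} eq with same-or-opp (col x) (col y)
    ... | inj₁ same = just-injective (trans (sym (edge-of-own x))
      (trans (cong₂ edge-end same eq) (edge-of-own y)))
    ... | inj₂ opposite = contradiction
      (edge-of-parent x y (trans (cong₂ edge-end (trans (cong opp opposite) (opp-opp (col y))) eq) (edge-of-own y)))
      (<-asym (edge-of-parent y x (trans (cong₂ edge-end (sym opposite) (sym eq)) (edge-of-own x))))

    n≡edges : n ≡ T.n
    n≡edges = sym (+-cancelʳ-≡ 1 T.n n (trans T.edge-count (+-comm 1 n)))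

    -- By `edge-count` there are as many edges as letters, so the injection `edge-of` is a
    -- bijection. This is where the connected map `T` is used as a tree.
    letter-of : E → X
    letter-of e = proj₁ (surjective n≡edges edge-of-injective e)

    edge-of-letter : ∀ e → edge-of (letter-of e) ≡ e
    edge-of-letter e = proj₂ (surjective n≡edges edge-of-injective e)

    letter-of-edge : ∀ x → letter-of (edge-of x) ≡ x
    letter-of-edge x = edge-of-injective (edge-of-letter (edge-of x))

    letter-rot : Colour → X → X
    letter-rot c x = letter-of (edge-rot c (edge-of x))

    code : Coded (k zero) val
    code .rot = letter-rot
    code .end c x = edge-end c (edge-of x)
    code .wt x = T.wt (edge-of x)
    code .rank = distance
    code .rot-inj c {x} {y} eq = edge-of-injective (edge-rot-inj c
      (trans (sym (edge-of-letter _)) (trans (cong edge-of eq) (edge-of-letter _))))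
    code .rot-end c x = trans (cong (edge-end c) (edge-of-letter _)) (edge-rot-end c (edge-of x))
    code .rot-cyc c x y _ _ eq = subst₂ (Orbit (letter-rot c)) (letter-of-edge x) (letter-of-edge y)
      (orbit-map letter-of (λ e → cong (letter-of ∘ edge-rot c) (sym (edge-of-letter e)))
        (edge-rot-cyc c (edge-of x) (edge-of y) eq))
    code .rot-fix c x vx≡0 = contradiction vx≡0 (active x)
    code .own = edge-of-own
    code .typed c x y = edge-typed c (edge-of x)
    code .rooted x ()
    code .ranked x y _ = edge-of-parent x y
    code .wt-zero x vx≡0 = contradiction vx≡0 (active x)
    code .wt-pos x _ wt≡0 = contradiction (subst (1 ≤_) wt≡0 (T.wt-pos (edge-of x))) λ ()
    code .deg y with i , eq , w≡v ← encode-letter y = begin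
      sumFin n (incidence′ (just y) ∘ edge-of)
        ≡⟨ sumFin-permute (incidence′ (just y)) edge-of letter-of edge-of-letter letter-of-edge ⟩
      sumFin T.n (incidence′ (just y))
        ≡⟨ cong (λ u → sumFin T.n (incidence′ u)) eq ⟨
      sumFin T.n (incidence′ (encode (col y) i))
        ≡⟨ edge-degree (col y) i ⟩
      weight (col y) i
        ≡⟨ w≡v ⟩
      val y ∎
      where
      open ≡-Reasoning
      incidence′ : Maybe X → E → ℕ
      incidence′ u e = if does (edge-end (col y) e ≟ᵛ u) then T.wt e else 0
    code .deg-root = trans
      (sumFin-permute (λ e → if does (edge-end white e ≟ᵛ nothing) then T.wt e else 0)
        edge-of letter-of edge-of-letter letter-of-edge)
      (edge-degree white zero)

    same⇒isotopic : (C : Coded (k zero) val) → Same code C → Isotopic T (toWTree C)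
    same⇒isotopic C same = record
      { π      = letter-of
      ; π-inj  = λ eq → trans (sym (edge-of-letter _)) (trans (cong edge-of eq) (edge-of-letter _))
      ; π-surj = λ x → edge-of x , letter-of-edge x
      ; φ      = id
      ; ψ      = id
      ; φ-inj  = id
      ; ψ-inj  = id
      ; φ-wt   = λ _ → refl
      ; ψ-wt   = λ _ → refl
      ; π-wv   = λ e → trans (cong (decode white) (ends white e)) (decode-encode white (T.wv e))
      ; π-bv   = λ e → trans (cong (decode black) (ends black e)) (decode-encode black (T.bv e))
      ; π-wt   = λ e → trans (sym (same-wt (letter-of e))) (cong T.wt (edge-of-letter e))
      ; π-σ    = rots white
      ; π-α    = rots black
      }
      where
      open Same same
      ends : ∀ c e → end C c (letter-of e) ≡ edge-end c e
      ends c e = trans (sym (same-end c (letter-of e) (active (letter-of e)))) (cong (edge-end c) (edge-of-letter e))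
      rots : ∀ c e → rot C c (letter-of e) ≡ letter-of (edge-rot c e)
      rots c e = trans (sym (same-rot c (letter-of e))) (cong (letter-of ∘ edge-rot c) (edge-of-letter e))

  -- From the hypotheses on the type to balance and genericity

  letters-white : ∀ P → colourSum col white P val ≡ sumFin s (λ a → if P (white-letter a) then k (suc a) else 0)
  letters-white P = trans (sumFin-++ s _) (trans (cong₂ _+_ (sumFin-cong whites) (sumFin-zero blacks)) (+-identityʳ _))
    where
    whites : ∀ a → colourTerm col white P val (white-letter a) ≡ (if P (white-letter a) then k (suc a) else 0)
    whites a = trans (colourTerm-on col P val (encode-typed white (suc a) refl))
      (cong (if P (white-letter a) then_else 0) (cong [ k ∘ suc , l ]′ (splitAt-↑ˡ s a (suc t))))
    blacks : ∀ b → colourTerm col white P val (black-letter b) ≡ 0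
    blacks b = colourTerm-off col P val λ eq → contradiction (trans (sym eq) (encode-typed black b refl)) λ ()

  letters-black : ∀ P → colourSum col black P val ≡ sumFin (suc t) (λ b → if P (black-letter b) then l b else 0)
  letters-black P = trans (sumFin-++ s _) (cong₂ _+_ (sumFin-zero whites) (sumFin-cong blacks))
    where
    whites : ∀ a → colourTerm col black P val (white-letter a) ≡ 0
    whites a = colourTerm-off col P val λ eq → contradiction (trans (sym eq) (encode-typed white (suc a) refl)) λ ()
    blacks : ∀ b → colourTerm col black P val (black-letter b) ≡ (if P (black-letter b) then l b else 0)
    blacks b = trans (colourTerm-on col P val (encode-typed black b refl))
      (cong (if P (black-letter b) then_else 0) (cong [ k ∘ suc , l ]′ (splitAt-↑ʳ s (suc t) b)))

  module _ (total : sumFin (suc s) k ≡ sumFin (suc t) l) where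

    balanced : Balanced (k zero) val
    balanced = begin
      colourSum col white (const true) val + k zero ≡⟨ cong (_+ k zero) (letters-white (const true)) ⟩
      sumFin s (k ∘ suc) + k zero                   ≡⟨ +-comm _ (k zero) ⟩
      sumFin (suc s) k                              ≡⟨ total ⟩
      sumFin (suc t) l                              ≡⟨ letters-black (const true) ⟨
      colourSum col black (const true) val          ∎
      where open ≡-Reasoning

    generic : NonDecomposable k l → Generic col val
    generic nondec P sums z Pz = contradiction equal (nondec I J I-nonempty (zero , ∁-tabulate Q refl) J-nonempty ∁J-nonempty)
      where
      Q : Fin (suc s) → Bool
      -- Leaving the root out makes the complement of `I` nonempty.
      Q zero    = false
      Q (suc a) = P (white-letter a)
      R : Fin (suc t) → Bool
      R = P ∘ black-letter
      I = tabulate Q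
      J = tabulate R

      I-sum : subsetSum I k ≡ colourSum col white P val
      I-sum = trans (subsetSum-tabulate Q k) (sym (letters-white P))
      J-sum : subsetSum J l ≡ colourSum col black P val
      J-sum = trans (subsetSum-tabulate R l) (sym (letters-black P))
      equal : subsetSum I k ≡ subsetSum J l
      equal = trans I-sum (trans sums (sym J-sum))

      at-z : ∀ c → col z ≡ c → colourSum col c P val ≢ 0
      at-z c z-c sum≡0 = active z (trans (sym (trans (colourTerm-on col P val z-c) (cong (if_then val z else 0) Pz)))
        (n≤0⇒n≡0 (subst (colourTerm col c P val z ≤_) sum≡0 (term≤sumFin (colourTerm col c P val) z))))
      positive : colourSum col white P val ≢ 0
      positive with same-or-opp (col z) white
      ... | inj₁ z-white = at-z white z-white
      ... | inj₂ z-black = at-z black z-black ∘ trans (sym sums)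

      if-true : ∀ {b : Bool} {m} → (if b then m else 0) ≢ 0 → b ≡ true
      if-true {true}  _  = refl
      if-true {false} ≢0 = contradiction refl ≢0

      I-nonempty : Nonempty I
      I-nonempty with a , ≢0 ← sumFin-positive _ (positive ∘ trans (letters-white P)) =
        suc a , ∈-tabulate⁺ Q (if-true ≢0)
      J-nonempty : Nonempty J
      J-nonempty with b , ≢0 ← sumFin-positive (λ b → if R b then l b else 0) (positive ∘ trans sums ∘ trans (letters-black P)) =
        b , ∈-tabulate⁺ R (if-true {R b} {l b} ≢0)

      ∁J-nonempty : Nonempty (∁ J)
      ∁J-nonempty with any? (λ b → R b ≟ᵇ false)
      ... | yes (b , Rb) = b , ∁-tabulate R Rb
      -- If `J` were everything, the sum over `I` would be the full total, although `I` omits the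
      -- positive weight `k zero`.
      ... | no all-in = contradiction total (λ total → <-irrefl (sym total) too-small)
        where
        full : ∀ b → R b ≡ true
        full b with R b in eq
        ... | true  = refl
        ... | false = contradiction (b , eq) all-in
        J-full : subsetSum J l ≡ sumFin (suc t) l
        J-full = trans (subsetSum-tabulate R l) (sumFin-cong λ b → cong (if_then l b else 0) (full b))
        too-small : sumFin (suc t) l < sumFin (suc s) k
        too-small = ≤-<-trans
          (≤-trans (≤-reflexive (trans (sym J-full) (trans (sym equal) (subsetSum-tabulate Q k))))
            (sumFin-mono λ a → if-≤ (P (white-letter a))))
          (+-monoˡ-< (sumFin s (k ∘ suc)) (k-pos zero))

    -- The list of trees

    module _ (simple : Simple k l) (nondec : NonDecomposable k l) where

      coded : (N : Cycle n) → Realized (k zero) val (next N)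
      coded N = realize _ ≤-refl (weight-pos white zero) balanced (generic nondec) (record
        { injective  = next-inj N
        ; fixed      = λ x vx≡0 → contradiction vx≡0 (active x)
        ; transitive = λ x y _ _ → next-orbit N x y
        })

      tree : Cycle n → WTree k l
      tree N = toWTree (proj₁ (coded N))

      trees : List (WTree k l)
      trees = map tree (cycles n)

      length-trees : length trees ≡ (n ∸ 1) !
      length-trees = trans (length-map tree (cycles n)) (length-cycles n)

      trees-distinct : AllPairs (λ T T′ → ¬ Isotopic T T′) trees
      trees-distinct = AllPairs.map⁺ (AllPairs.map distinct (cycles-distinct n))
        where
        distinct : ∀ {N M} → ¬ (next N ≗ next M) → ¬ Isotopic (tree N) (tree M)
        distinct {N} {M} N≢M iso = N≢M λ x → trans (sym (proj₂ (coded N) x)) (trans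
          (isotopic⇒face (proj₁ simple) (proj₂ simple) (proj₁ (coded N)) (proj₁ (coded M)) iso x)
          (proj₂ (coded M) x))

      trees-complete : ∀ T → Any (Isotopic T) trees
      -- The face permutation of `T` agrees pointwise with a listed cycle, and the tree built from
      -- that cycle has this face permutation too; `face-determines` identifies the two trees.
      trees-complete T = Any.map⁺ (Any.map isotopic (cycles-complete n N))
        where
        C = code T
        N : Cycle n
        N = cycle (face C) (face-inj C) λ x y → face-transitive _ ≤-refl C x y (active x) (active y)
        isotopic : ∀ {M} → next N ≗ next M → Isotopic T (tree M)
        isotopic {M} N≗M = same⇒isotopic T (proj₁ (coded M))
          (face-determines _ ≤-refl C (proj₁ (coded M)) λ x → trans (N≗M x) (sym (proj₂ (coded M) x)))

theorem2 : (s t : ℕ) → 1 ≤ s → 1 ≤ t →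
    (k : Fin s → ℕ) (l : Fin t → ℕ) →
    (∀ i → 1 ≤ k i) → (∀ j → 1 ≤ l j) →
    sumFin s k ≡ sumFin t l →
    Simple k l → NonDecomposable k l →
    Σ (List (WTree k l)) λ L →
    (length L ≡ (s + t ∸ 2) !) ×
    AllPairs (λ T T' → ¬ Isotopic T T') L ×
    (∀ T → Any (Isotopic T) L)
theorem2 (suc s) (suc t) _ _ k l k-pos l-pos total simple nondec =
  trees total simple nondec ,
  -- `suc s + suc t ∸ 2` computes to `s + suc t ∸ 1`, one less than the number of letters.
  length-trees total simple nondec ,
  trees-distinct total simple nondec ,
  trees-complete total simple nondec
  where open Trees k l k-pos l-pos
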